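{- Let $D$ be a strongly connected balanced bipartite digraph of order $2a$, where $a\geq 3$, and let $k$ be an integer satisfying $\max\{1,\frac{a}{4}\}<k\leq\frac{a}{2}$. Suppose that for every dominating pair $\{u,v\}$ of vertices in $D$, \[ d(u)\geq 2a-k\ \text{and}\ d(v)\geq a+k,\quad\text{or}\quad d(u)\geq a+k\ \text{and}\ d(v)\geq 2a-k. \] Then $D$ is either bipancyclic or a directed cycle of length $2a$.
   Context: Digraphs have no loops and no multiple arcs (2-cycles $uv, vu$ are allowed). For a vertex $v$, $d^+(v)$ and $d^-(v)$ are its out- and in-degree, and $d(v)=d^+(v)+d^-(v)$. A pair of distinct vertices $\{u,v\}$ is dominating if there is a vertex $w$ with $uw$ and $vw$ both arcs of $D$. A bipartite digraph is balanced if its two partite sets have equal size. A balanced bipartite digraph is bipancyclic if it contains directed cycles of all even lengths $2,4,\dots,|V(D)|$. -}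

module Defs where

open import Data.Nat using (ℕ; zero; suc; _+_; _*_; _<_; _≤_; NonZero)
open import Data.Nat.DivMod using (_%_; m%n<n)
open import Data.Fin using (Fin; toℕ; fromℕ<)
open import Data.Bool using (Bool; true; false)
open import Data.Sum using (_⊎_; inj₁; inj₂)
open import Data.Product using (Σ; ∃; _×_; _,_)
open import Data.Empty using (⊥)
open import Function.Definitions using (Injective)
open import Relation.Binary.PropositionalEquality using (_≡_)
open import Relation.Binary.Construct.Closure.ReflexiveTransitive using (Star)
open import Relation.Nullary using (¬_)

-- A balanced bipartite digraph with partite sets X = Y = Fin a (tagged inj₁ / inj₂).
-- xy x y = true  iff  x → y is an arc;  yx y x = true  iff  y → x is an arc.
-- No loops, no multiple arcs (arcs form a relation), 2-cycles allowed.
record BBDigraph (a : ℕ) : Set where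
  field
    xy : Fin a → Fin a → Bool
    yx : Fin a → Fin a → Bool

Vertex : ℕ → Set
Vertex a = Fin a ⊎ Fin a

module _ {a : ℕ} (D : BBDigraph a) where
  open BBDigraph D

  arcB : Vertex a → Vertex a → Bool
  arcB (inj₁ x) (inj₂ y) = xy x y
  arcB (inj₂ y) (inj₁ x) = yx y x
  arcB (inj₁ _) (inj₁ _) = false
  arcB (inj₂ _) (inj₂ _) = false

  Arc : Vertex a → Vertex a → Set
  Arc u v = arcB u v ≡ true

countF : ∀ {n} → (Fin n → Bool) → ℕ
countF {zero} f = 0
countF {suc n} f with f Fin.zero
... | true  = suc (countF (λ i → f (Fin.suc i)))
... | false = countF (λ i → f (Fin.suc i))

countV : ∀ {a} → (Vertex a → Bool) → ℕ
countV f = countF (λ i → f (inj₁ i)) + countF (λ i → f (inj₂ i))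

module _ {a : ℕ} (D : BBDigraph a) where
  outdeg indeg deg : Vertex a → ℕ
  outdeg v = countV (λ w → arcB D v w)
  indeg v = countV (λ w → arcB D w v)
  deg v = outdeg v + indeg v

  StronglyConnected : Set
  StronglyConnected = ∀ u v → Star (Arc D) u v

  Dominating : Vertex a → Vertex a → Set
  Dominating u v = ¬ (u ≡ v) × ∃ λ w → Arc D u w × Arc D v w

sucMod : ∀ {n} → Fin n → Fin n
sucMod {suc n} i = fromℕ< (m%n<n (suc (toℕ i)) (suc n))

module _ {a : ℕ} (D : BBDigraph a) where
  IsCycle : (m : ℕ) → (Fin m → Vertex a) → Set
  IsCycle m c = Injective _≡_ _≡_ c × (∀ i → Arc D (c i) (c (sucMod i)))

  HasCycle : ℕ → Set
  HasCycle m = Σ (Fin m → Vertex a) (IsCycle m)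

  Bipancyclic : Set
  Bipancyclic = ∀ m → 1 ≤ m → m ≤ a → HasCycle (2 * m)

  IsDirectedCycle : Set
  IsDirectedCycle = Σ (Fin (2 * a) → Vertex a) λ c → IsCycle (2 * a) c ×
    (∀ u v → Arc D u v → ∃ λ i → c i ≡ u × c (sucMod i) ≡ v)

{-# OPTIONS --safe #-}
module Submission where

-- If some vertex has degree below a + k, it is in no dominating pair, so its out-neighbours have
-- in-degree 1 and again low degree; strong connectivity then forces D to be a directed cycle.
-- Otherwise call a vertex low when its degree is below 2a − k: low vertices have disjoint
-- out-neighbourhoods, and Hall's theorem yields a permutation N of the vertices along arcs.
-- If S and T are unions of cycles of N and no u ∈ S, v ∈ T allow both arcs u → N v and v → N u
-- (which would merge their cycles), then at most half of the possible arcs between S and T are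
-- present. Comparing this with the degree sum of S leaves only the case a = 2k with S and T
-- complete halves, where rewiring the halves gives a merge. Hence D is Hamiltonian.
-- The same count with the two vertices N u, N² u left out of a Hamiltonian cycle, split by arcs
-- u → N v and v → N³ u, yields a cycle of length 2a − 2; a vertex off that cycle is adjacent to it
-- often enough to lie on cycles of all even lengths up to 2a − 2.

open import Defs
open import Data.Bool using (Bool; true; false; not; _∧_; _∨_; _xor_)
import Data.Bool.Properties as Bool
open import Data.Empty using (⊥; ⊥-elim)
open import Data.Fin as Fin using (Fin; toℕ; _≟_; splitAt; join; _↑ˡ_; _↑ʳ_)
open import Data.Fin.Permutation using (permutation)
open import Data.Fin.Properties as Fin using (any?; pigeonhole)
open import Data.Nat using (ℕ; zero; suc; _+_; _*_; _∸_; _<_; _≤_; z≤n; s≤s; s≤s⁻¹; _<?_; >-nonZero)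
open import Data.Nat.DivMod using (_%_; m<n⇒m%n≡m; n%n≡0)
open import Data.Nat.GeneralisedArithmetic using (iterate)
open import Data.Nat.Properties hiding (_≟_)
open import Data.Nat.Tactic.RingSolver using (solve-∀)
open import Data.Product using (Σ; ∃; _×_; _,_; proj₁; proj₂) renaming (swap to ×-swap)
open import Data.Sum using (_⊎_; inj₁; inj₂)
open import Function using (_∘_; case_of_)
open import Function.Definitions using (Injective)
open import Algebra.Properties.Semiring.Sum +-*-semiring
open import Relation.Binary.Construct.Closure.ReflexiveTransitive using (Star; ε; _◅_)
open import Relation.Binary.Definitions using (tri<; tri≈; tri>)
open import Relation.Binary.PropositionalEquality
open import Relation.Nullary using (¬_; Dec; yes; no; does; contradiction)
open import Relation.Nullary.Decidable using (_×-dec_; _⊎-dec_; ¬?; dec-true; dec-false; decidable-stable)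

-- The two bounds on `k` enter separately. From `2 * k ≤ a` every member of a dominating pair has
-- degree at least `a + k`. From `a < 4 * k` the shortfall `δ = a - 2k` of a low vertex is below
-- `2k`, hence at most `2m`, the size of the smaller part `S`, once `k ≤ m` is known. So the
-- allowance for low vertices never exceeds `2δ`, however many there are: their disjoint
-- out-neighbourhoods cost arcs inside `S`. The count is stated once, for a partition into `S`, `T`
-- and a remainder of `2r` vertices with `r ≤ 1`. For `r = 1` it would be one arc too weak. That arc
-- comes from a dichotomy: an arc from some `w` to `N³ w` gives a cycle of length `2a - 2` at once,
-- and otherwise a non-arc `w → N³ w` with one end in the remainder helps the count. The extremal
-- sizes `m = t = k` remain, but for each `u` at most one `v` produces them, and one exception per
-- vertex cannot make up for `k ≥ 2` in the sum of all degrees.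

private variable
  n : ℕ

-- Finite sums, permutations and Hall's theorem

ι : Bool → ℕ
ι true  = 1
ι false = 0

infix 7 _==_
_==_ : Fin n → Fin n → Bool
i == j = does (i ≟ j)

==-refl : (i : Fin n) → i == i ≡ true
==-refl i = dec-true (i ≟ i) refl

==⇒≡ : {i j : Fin n} → i == j ≡ true → i ≡ j
==⇒≡ {i = i} {j} e with i ≟ j
... | yes p = p
==⇒≡ () | no _

not-true⇒false : {b : Bool} → ¬ (b ≡ true) → b ≡ false
not-true⇒false {true}  p = contradiction refl p
not-true⇒false {false} p = refl

ι≤1 : ∀ b → ι b ≤ 1
ι≤1 true  = ≤-refl
ι≤1 false = z≤n

b≢not-b : {b : Bool} → ¬ (b ≡ not b)
b≢not-b {true}  ()
b≢not-b {false} ()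

∧-split : ∀ b c → b ∧ c ≡ true → b ≡ true × c ≡ true
∧-split true true _ = refl , refl

∨-split : ∀ b c → b ∨ c ≡ true → b ≡ true ⊎ c ≡ true
∨-split true  c e = inj₁ refl
∨-split false c e = inj₂ e

true≢false : {A : Set} {b : Bool} → b ≡ true → b ≡ false → A
true≢false refl ()

does⇒ : {A : Set} (d : Dec A) → does d ≡ true → A
does⇒ (yes a) _ = a

¬does⇒ : {A : Set} (d : Dec A) → does d ≡ false → ¬ A
¬does⇒ (no ¬a) _ = ¬a

sum-mono : {f g : Fin n → ℕ} → (∀ i → f i ≤ g i) → sum f ≤ sum g
sum-mono {zero}  p = z≤n
sum-mono {suc n} p = +-mono-≤ (p Fin.zero) (sum-mono (p ∘ Fin.suc))

sum-mono-at : {f g : Fin n → ℕ} (c : ℕ) → (∀ i → f i ≤ g i) → ∀ j → f j + c ≤ g j → sum f + c ≤ sum g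
sum-mono-at {suc n} {f} {g} c p Fin.zero q = begin
  f Fin.zero + sum (f ∘ Fin.suc) + c   ≡⟨ +-assoc (f Fin.zero) _ c ⟩
  f Fin.zero + (sum (f ∘ Fin.suc) + c) ≡⟨ cong (f Fin.zero +_) (+-comm _ c) ⟩
  f Fin.zero + (c + sum (f ∘ Fin.suc)) ≡⟨ +-assoc (f Fin.zero) c _ ⟨
  f Fin.zero + c + sum (f ∘ Fin.suc)   ≤⟨ +-mono-≤ q (sum-mono (p ∘ Fin.suc)) ⟩
  g Fin.zero + sum (g ∘ Fin.suc)       ∎
  where open ≤-Reasoning
sum-mono-at {suc n} {f} {g} c p (Fin.suc j) q = begin
  f Fin.zero + sum (f ∘ Fin.suc) + c   ≡⟨ +-assoc (f Fin.zero) _ c ⟩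
  f Fin.zero + (sum (f ∘ Fin.suc) + c) ≤⟨ +-mono-≤ (p Fin.zero) (sum-mono-at c (p ∘ Fin.suc) j q) ⟩
  g Fin.zero + sum (g ∘ Fin.suc)       ∎
  where open ≤-Reasoning

sum-const : ∀ n c → sum {n} (λ _ → c) ≡ n * c
sum-const zero    c = refl
sum-const (suc n) c = cong (c +_) (sum-const n c)

sum-zero : ∀ n → sum {n} (λ _ → 0) ≡ 0
sum-zero n = trans (sum-const n 0) (*-zeroʳ n)

sum-δ : (i : Fin n) (f : Fin n → ℕ) → ∑[ j < n ] (ι (i == j) * f j) ≡ f i
sum-δ {suc n} Fin.zero f = begin
  f Fin.zero + 0 + ∑[ j < n ] 0 ≡⟨ cong₂ _+_ (+-identityʳ _) (sum-zero n) ⟩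
  f Fin.zero + 0                ≡⟨ +-identityʳ _ ⟩
  f Fin.zero                    ∎
  where open ≡-Reasoning
sum-δ {suc n} (Fin.suc i) f = sum-δ i (f ∘ Fin.suc)

sum-==ʳ : (i : Fin n) → ∑[ j < n ] ι (i == j) ≡ 1
sum-==ʳ i = trans (sum-cong-≗ λ j → sym (*-identityʳ (ι (i == j)))) (sum-δ i (λ _ → 1))

sum-unique : (b : Fin n → Bool) → (∀ i j → b i ≡ true → b j ≡ true → i ≡ j) → sum (ι ∘ b) ≤ 1
sum-unique {n} b u with any? (λ i → b i Bool.≟ true)
... | yes (i , bi) = subst (sum (ι ∘ b) ≤_) (sum-==ʳ i) (sum-mono le)
  where
  le : ∀ j → ι (b j) ≤ ι (i == j)
  le j with b j in bj
  ... | false = z≤n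
  ... | true rewrite u i j bi bj | ==-refl j = ≤-refl
... | no ¬b = ≤-trans (sum-mono le) (≤-trans (≤-reflexive (sum-zero n)) z≤n)
  where
  le : ∀ j → ι (b j) ≤ 0
  le j rewrite not-true⇒false (λ bj → ¬b (j , bj)) = z≤n

sum-witness : (f : Fin n → ℕ) → 0 < sum f → ∃ λ i → 0 < f i
sum-witness {suc n} f p with f Fin.zero in eq
... | suc m = Fin.zero , subst (0 <_) (sym eq) (s≤s z≤n)
... | zero  with i , q ← sum-witness (f ∘ Fin.suc) p = Fin.suc i , q

ι-witness : {b : Bool} → 0 < ι b → b ≡ true
ι-witness {true} _ = refl

iterate-suc : {A : Set} (f : A → A) (x : A) (i : ℕ) → iterate f x (suc i) ≡ f (iterate f x i)
iterate-suc f x zero    = refl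
iterate-suc f x (suc i) = iterate-suc f (f x) i

iterate-+ : {A : Set} (f : A → A) (x : A) (i j : ℕ) → iterate f x (i + j) ≡ iterate f (iterate f x i) j
iterate-+ f x zero    j = refl
iterate-+ f x (suc i) j = iterate-+ f (f x) i j

module _ {A : Set} {N : A → A} (inj : Injective _≡_ _≡_ N) where

  iterate-injective : ∀ i → Injective _≡_ _≡_ (λ x → iterate N x i)
  iterate-injective zero    e = e
  iterate-injective (suc i) e = inj (iterate-injective i e)

  iterate-cancel : ∀ {x} i d → iterate N x i ≡ iterate N x (i + d) → x ≡ iterate N x d
  iterate-cancel {x} i d e = iterate-injective i (begin
    iterate N x i                ≡⟨ e ⟩
    iterate N x (i + d)          ≡⟨ cong (iterate N x) (+-comm i d) ⟩
    iterate N x (d + i)          ≡⟨ iterate-+ N x d i ⟩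
    iterate N (iterate N x d) i  ∎)
    where open ≡-Reasoning

module _ {N : Fin n → Fin n} (inj : Injective _≡_ _≡_ N) where

  abstract
    -- Two of the iterates of `r` with index at most `n` coincide, and injectivity cancels the
    -- common start, so the walk returns to `r` itself.
    period : ∀ r → ∃ λ p → p < n × iterate N r (suc p) ≡ r
    period r with pigeonhole {m = n} {n = suc n} ≤-refl (λ i → iterate N r (toℕ i))
    ... | i , j , i<j , e with m≤n⇒∃[o]m+o≡n i<j
    ... | d , eq =
      d , d<n , sym (iterate-cancel inj (toℕ i) (suc d) (trans e (cong (iterate N r) (sym eq′))))
      where
      eq′ : toℕ i + suc d ≡ toℕ j
      eq′ = trans (+-suc (toℕ i) d) eq
      d<n : d < n
      d<n = s≤s⁻¹ (<-≤-trans (s≤s (subst (suc d ≤_) eq′ (m≤n+m (suc d) (toℕ i)))) (Fin.toℕ<n j))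

  inverse : Fin n → Fin n
  inverse w = iterate N w (proj₁ (period w))

  inverseʳ : ∀ w → N (inverse w) ≡ w
  inverseʳ w = trans (sym (iterate-suc N w (proj₁ (period w)))) (proj₂ (proj₂ (period w)))

  inverseˡ : ∀ v → inverse (N v) ≡ v
  inverseˡ v = inj (inverseʳ (N v))

  sum-reindex : (f : Fin n → ℕ) → sum f ≡ sum (f ∘ N)
  sum-reindex f = sum-permute f (permutation N inverse inverseʳ inverseˡ)

∣_∣ : (Fin n → Bool) → ℕ
∣ S ∣ = sum (ι ∘ S)

∣∣≤ : (S : Fin n → Bool) → ∣ S ∣ ≤ n
∣∣≤ {n} S = subst (∣ S ∣ ≤_) (trans (sum-const n 1) (*-identityʳ n)) (sum-mono (ι≤1 ∘ S))

-- Hall's theorem by Rado's edge deletion argument.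
module Hall {n m : ℕ} where

  Matching : (Fin n → Fin m → Bool) → Set
  Matching E = Σ (Fin n → Fin m) λ f → Injective _≡_ _≡_ f × (∀ x → E x (f x) ≡ true)

  Violator : (Fin n → Fin m → Bool) → Set
  Violator E = Σ (Fin n → Bool) λ A → Σ (Fin m → Bool) λ B →
    (∀ x y → A x ≡ true → E x y ≡ true → B y ≡ true) × ∣ B ∣ < ∣ A ∣

  edges : (Fin n → Fin m → Bool) → ℕ
  edges E = ∑[ x < n ] ∑[ y < m ] ι (E x y)

  delete : Fin n → Fin m → (Fin n → Fin m → Bool) → Fin n → Fin m → Bool
  delete x y E u v = E u v ∧ not (x == u ∧ y == v)

  delete-⊆ : ∀ x y (E : Fin n → Fin m → Bool) u v → delete x y E u v ≡ true → E u v ≡ true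
  delete-⊆ x y E u v e with E u v
  ... | true = refl

  delete-keeps : ∀ x y (E : Fin n → Fin m → Bool) u v → E u v ≡ true → ¬ (x ≡ u × y ≡ v) →
    delete x y E u v ≡ true
  delete-keeps x y E u v e p rewrite e with x ≟ u | y ≟ v
  ... | yes q | yes r = contradiction (q , r) p
  ... | yes q | no  r = refl
  ... | no  q | yes r = refl
  ... | no  q | no  r = refl

  edges-delete : ∀ x y (E : Fin n → Fin m → Bool) → E x y ≡ true → edges (delete x y E) < edges E
  edges-delete x y E e = subst (_≤ edges E) (+-comm _ 1)
    (sum-mono-at 1 (λ u → sum-mono (le u)) x (sum-mono-at 1 (le x) y at))
    where
    le : ∀ u v → ι (delete x y E u v) ≤ ι (E u v)
    le u v with E u v
    ... | false = z≤n
    ... | true  = ι≤1 _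
    at : ι (delete x y E x y) + 1 ≤ ι (E x y)
    at rewrite e | ==-refl x | ==-refl y = ≤-refl

  violator-weaken : ∀ x y (E : Fin n → Fin m → Bool) → (V : Violator (delete x y E)) →
    proj₁ V x ≡ false → Violator E
  violator-weaken x y E (A , B , cl , lt) x∉A = A , B , cl′ , lt
    where
    cl′ : ∀ u v → A u ≡ true → E u v ≡ true → B v ≡ true
    cl′ u v u∈A e = cl u v u∈A (delete-keeps x y E u v e λ { (refl , _) → true≢false u∈A x∉A })

  -- A violating set that avoids `x` violates `E` as well. Otherwise `A₁ ∪ A₂` has its neighbours in
  -- `B₁ ∪ B₂`, each deleted edge being covered by the other violator, and `A₁ ∩ A₂` without `x` has
  -- its neighbours in `B₁ ∩ B₂`. The two deficits add up to at least 2 and dropping `x` costs 1, so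
  -- one of these sets is still deficient.
  violator-combine : ∀ x y z (E : Fin n → Fin m → Bool) → ¬ (y ≡ z) → E x y ≡ true → E x z ≡ true →
    Violator (delete x y E) → Violator (delete x z E) → Violator E
  violator-combine x y z E y≢z xy xz V₁@(A₁ , B₁ , cl₁ , lt₁) V₂@(A₂ , B₂ , cl₂ , lt₂)
    with A₁ x in x∈A₁ | A₂ x in x∈A₂
  ... | false | _ = violator-weaken x y E V₁ x∈A₁
  ... | true | false = violator-weaken x z E V₂ x∈A₂
  ... | true | true with ∣ (λ v → B₁ v ∨ B₂ v) ∣ <? ∣ (λ u → A₁ u ∨ A₂ u) ∣
  ...   | yes lt = (λ u → A₁ u ∨ A₂ u) , (λ v → B₁ v ∨ B₂ v) , cl , lt
    where
    cl : ∀ u v → A₁ u ∨ A₂ u ≡ true → E u v ≡ true → B₁ v ∨ B₂ v ≡ true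
    cl u v u∈ e with A₁ u in u∈A₁ | x ≟ u | y ≟ v
    cl u v u∈ e | true | yes refl | yes refl
      rewrite cl₂ x y x∈A₂ (delete-keeps x z E x y xy λ { (_ , q) → y≢z (sym q) }) = Bool.∨-zeroʳ _
    cl u v u∈ e | true | yes _ | no q
      rewrite cl₁ u v u∈A₁ (delete-keeps x y E u v e (q ∘ proj₂)) = refl
    cl u v u∈ e | true | no q | _
      rewrite cl₁ u v u∈A₁ (delete-keeps x y E u v e (q ∘ proj₁)) = refl
    cl u v u∈ e | false | yes refl | _ = true≢false x∈A₁ u∈A₁
    cl u v u∈ e | false | no q | _
      rewrite cl₂ u v u∈ (delete-keeps x z E u v e (q ∘ proj₁)) = Bool.∨-zeroʳ _
  ...   | no ¬lt = A , (λ v → B₁ v ∧ B₂ v) , cl , +-cancelˡ-< ∣ (λ v → B₁ v ∨ B₂ v) ∣ _ _ lt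
    where
    A : Fin n → Bool
    A u = (A₁ u ∧ A₂ u) ∧ not (x == u)
    cl : ∀ u v → A u ≡ true → E u v ≡ true → B₁ v ∧ B₂ v ≡ true
    cl u v u∈ e with A₁ u in u∈A₁ | A₂ u in u∈A₂ | x ≟ u
    ... | true | true | no q
      rewrite cl₁ u v u∈A₁ (delete-keeps x y E u v e (q ∘ proj₁))
            | cl₂ u v u∈A₂ (delete-keeps x z E u v e (q ∘ proj₁)) = refl
    ∨∧ : ∀ b c → ι (b ∨ c) + ι (b ∧ c) ≡ ι b + ι c
    ∨∧ true  true  = refl
    ∨∧ true  false = refl
    ∨∧ false true  = refl
    ∨∧ false false = refl
    sizeA : ∣ A₁ ∣ + ∣ A₂ ∣ ≤ ∣ (λ u → A₁ u ∨ A₂ u) ∣ + (∣ A ∣ + 1)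
    sizeA = begin
      ∣ A₁ ∣ + ∣ A₂ ∣ ≡⟨ ∑-distrib-+ (ι ∘ A₁) (ι ∘ A₂) ⟨
      ∑[ u < n ] (ι (A₁ u) + ι (A₂ u)) ≤⟨ sum-mono le ⟩
      ∑[ u < n ] (ι (A₁ u ∨ A₂ u) + (ι (A u) + ι (x == u)))
        ≡⟨ ∑-distrib-+ (λ u → ι (A₁ u ∨ A₂ u)) (λ u → ι (A u) + ι (x == u)) ⟩
      ∣ (λ u → A₁ u ∨ A₂ u) ∣ + ∑[ u < n ] (ι (A u) + ι (x == u))
        ≡⟨ cong (∣ (λ u → A₁ u ∨ A₂ u) ∣ +_)
        (trans (∑-distrib-+ (ι ∘ A) (λ u → ι (x == u))) (cong (∣ A ∣ +_) (sum-==ʳ x))) ⟩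
      ∣ (λ u → A₁ u ∨ A₂ u) ∣ + (∣ A ∣ + 1) ∎
      where
      open ≤-Reasoning
      le : ∀ u → ι (A₁ u) + ι (A₂ u) ≤ ι (A₁ u ∨ A₂ u) + (ι (A u) + ι (x == u))
      le u with A₁ u | A₂ u | x ≟ u
      ... | true | true | yes _ = ≤-refl
      ... | true | true | no _ = ≤-refl
      ... | true | false | _ = m≤m+n 1 _
      ... | false | true | _ = m≤m+n 1 _
      ... | false | false | _ = z≤n
    lt : ∣ (λ v → B₁ v ∨ B₂ v) ∣ + ∣ (λ v → B₁ v ∧ B₂ v) ∣ < ∣ (λ v → B₁ v ∨ B₂ v) ∣ + ∣ A ∣
    lt = +-cancelʳ-≤ 1 _ _ (begin
      suc (∣ (λ v → B₁ v ∨ B₂ v) ∣ + ∣ (λ v → B₁ v ∧ B₂ v) ∣) + 1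
        ≡⟨ cong (λ s → suc s + 1)
          (trans (sym (∑-distrib-+ (λ v → ι (B₁ v ∨ B₂ v)) (λ v → ι (B₁ v ∧ B₂ v))))
            (trans (sum-cong-≗ λ v → ∨∧ (B₁ v) (B₂ v)) (∑-distrib-+ (ι ∘ B₁) (ι ∘ B₂)))) ⟩
      suc (∣ B₁ ∣ + ∣ B₂ ∣) + 1 ≡⟨ +-comm _ 1 ⟩
      suc (suc (∣ B₁ ∣ + ∣ B₂ ∣)) ≡⟨ cong suc (+-suc ∣ B₁ ∣ ∣ B₂ ∣) ⟨
      suc ∣ B₁ ∣ + suc ∣ B₂ ∣ ≤⟨ +-mono-≤ lt₁ lt₂ ⟩
      ∣ A₁ ∣ + ∣ A₂ ∣ ≤⟨ sizeA ⟩
      ∣ (λ u → A₁ u ∨ A₂ u) ∣ + (∣ A ∣ + 1) ≡⟨ +-assoc _ ∣ A ∣ 1 ⟨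
      ∣ (λ u → A₁ u ∨ A₂ u) ∣ + ∣ A ∣ + 1 ≤⟨ +-monoˡ-≤ 1 (+-monoˡ-≤ ∣ A ∣ (≮⇒≥ ¬lt)) ⟩
      ∣ (λ v → B₁ v ∨ B₂ v) ∣ + ∣ A ∣ + 1 ∎)
      where open ≤-Reasoning

  branching? : ∀ (E : Fin n → Fin m → Bool) →
    Dec (∃ λ x → ∃ λ y → ∃ λ z → ¬ (y ≡ z) × E x y ≡ true × E x z ≡ true)
  branching? E = any? λ x → any? λ y → any? λ z →
    ¬? (y ≟ z) ×-dec ((E x y Bool.≟ true) ×-dec (E x z Bool.≟ true))

  -- Without branching, `f x` is the only neighbour of `x`. Two vertices with the same neighbour
  -- therefore form a violating set, and if there are none, `f` is a matching.
  functional : ∀ (E : Fin n → Fin m → Bool) →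
    ¬ (∃ λ x → ∃ λ y → ∃ λ z → ¬ (y ≡ z) × E x y ≡ true × E x z ≡ true) →
    (f : Fin n → Fin m) → (∀ x → E x (f x) ≡ true) → Matching E ⊎ Violator E
  functional E ¬br f Ef with any? (λ x → any? λ x′ → ¬? (x ≟ x′) ×-dec (f x ≟ f x′))
  ... | yes (x , x′ , x≢x′ , fx) = inj₂ ((λ u → x == u ∨ x′ == u) , (f x ==_) , cl , lt)
    where
    only : ∀ u v → E u v ≡ true → f u ≡ v
    only u v e with f u ≟ v
    ... | yes p = p
    ... | no p = contradiction (u , f u , v , p , Ef u , e) ¬br
    cl : ∀ u v → x == u ∨ x′ == u ≡ true → E u v ≡ true → f x == v ≡ true
    cl u v u∈ e with x ≟ u | x′ ≟ u
    ... | yes refl | _ = dec-true (f x ≟ v) (only x v e)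
    ... | no _ | yes refl = dec-true (f x ≟ v) (trans fx (only x′ v e))
    lt : ∣ (λ v → f x == v) ∣ < ∣ (λ u → x == u ∨ x′ == u) ∣
    lt = begin
      suc ∣ (λ v → f x == v) ∣ ≡⟨ cong suc (sum-==ʳ (f x)) ⟩
      1 + 1 ≡⟨ cong₂ _+_ (sum-==ʳ x) (sum-==ʳ x′) ⟨
      ∣ (λ u → x == u) ∣ + ∣ (λ u → x′ == u) ∣ ≡⟨ ∑-distrib-+ (λ u → ι (x == u)) (λ u → ι (x′ == u)) ⟨
      ∑[ u < n ] (ι (x == u) + ι (x′ == u)) ≤⟨ sum-mono le ⟩
      ∣ (λ u → x == u ∨ x′ == u) ∣ ∎
      where
      open ≤-Reasoning
      le : ∀ u → ι (x == u) + ι (x′ == u) ≤ ι (x == u ∨ x′ == u)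
      le u with x ≟ u | x′ ≟ u
      ... | yes refl | yes refl = contradiction refl x≢x′
      ... | yes _ | no _ = ≤-refl
      ... | no _ | yes _ = ≤-refl
      ... | no _ | no _ = ≤-refl
  ... | no ¬coll = inj₁ (f , (λ {x} {y} → f-inj x y) , Ef)
    where
    f-inj : ∀ x y → f x ≡ f y → x ≡ y
    f-inj x y e with x ≟ y
    ... | yes p = p
    ... | no p = contradiction (x , y , p , e) ¬coll

  unbranched : ∀ (E : Fin n → Fin m → Bool) →
    ¬ (∃ λ x → ∃ λ y → ∃ λ z → ¬ (y ≡ z) × E x y ≡ true × E x z ≡ true) →
    Matching E ⊎ Violator E
  unbranched E ¬br with any? (λ x → ¬? (any? λ y → E x y Bool.≟ true))
  ... | yes (x , none) = inj₂ ((x ==_) , (λ _ → false) ,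
      (λ { u v u∈ e → case ==⇒≡ {i = x} u∈ of λ { refl → contradiction (v , e) none } }) ,
      subst₂ _<_ (sym (sum-zero m)) (sym (sum-==ʳ x)) ≤-refl)
  ... | no all = functional E ¬br (proj₁ ∘ out) (proj₂ ∘ out)
    where
    out : ∀ x → ∃ λ y → E x y ≡ true
    out x = decidable-stable (any? λ y → E x y Bool.≟ true) λ none → all (x , none)

  hall-fuel : ∀ k (E : Fin n → Fin m → Bool) → edges E < k → Matching E ⊎ Violator E
  hall-fuel (suc k) E lt with branching? E
  ... | no ¬br = unbranched E ¬br
  ... | yes (x , y , z , y≢z , xy , xz)
    with hall-fuel k (delete x y E) (<-≤-trans (edges-delete x y E xy) (s≤s⁻¹ lt))
       | hall-fuel k (delete x z E) (<-≤-trans (edges-delete x z E xz) (s≤s⁻¹ lt))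
  ...   | inj₁ (f , inj , Ef) | _ = inj₁ (f , inj , λ u → delete-⊆ x y E u (f u) (Ef u))
  ...   | inj₂ _ | inj₁ (f , inj , Ef) = inj₁ (f , inj , λ u → delete-⊆ x z E u (f u) (Ef u))
  ...   | inj₂ V₁ | inj₂ V₂ = inj₂ (violator-combine x y z E y≢z xy xz V₁ V₂)

  hall : ∀ (E : Fin n → Fin m → Bool) → Matching E ⊎ Violator E
  hall E = hall-fuel (suc (edges E)) E ≤-refl

-- Arithmetic of the extremal case

-- Here m = |S|/2, t = |T|/2, r = |R|/2, e counts the arcs inside S and l the low vertices of S.
extremal-sizes : ∀ {a k δ h m t r e l} → 2 ≤ k → a < 4 * k → 2 * k + δ ≡ a → h + k ≡ 2 * a →
  r ≤ 1 → 1 ≤ m → m ≤ t → m + t + r ≡ a →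
  e ≤ 2 * m * m → e + l * m ≤ 2 * m * m + 2 * m →
  2 * m * (a + k) + r ≤ 2 * m * t + 2 * e + 4 * m * r →
  2 * m * h + r ≤ 2 * m * t + 2 * e + 4 * m * r + l * δ →
  m ≡ k × t ≡ k
extremal-sizes {a} {k} {δ} {h} {m} {t} {r} {e} {l} 2≤k a<4k δ-def h-def r≤1 1≤m m≤t sizes e≤ le≤ I₁ I₂ =
  m≡k , t≡k
  where
  open ≤-Reasoning
  -- Here `e` is replaced by its maximum `2 m²`, all possible arcs inside `S`.
  k≤m : k ≤ m
  k≤m = s≤s⁻¹ (*-cancelˡ-< (2 * m) k (suc m) (bound r r≤1 (+-cancelˡ-≤ (2 * m * a) _ _ (begin
    2 * m * a + (2 * m * k + r) ≡⟨ lhs m a k r ⟩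
    2 * m * (a + k) + r ≤⟨ I₁ ⟩
    2 * m * t + 2 * e + 4 * m * r ≤⟨ +-monoˡ-≤ (4 * m * r) (+-monoʳ-≤ (2 * m * t) (*-monoʳ-≤ 2 e≤)) ⟩
    2 * m * t + 2 * (2 * m * m) + 4 * m * r ≡⟨ rhs m t r ⟩
    2 * m * (m + t + r) + 2 * m * (m + r) ≡⟨ cong (λ x → 2 * m * x + 2 * m * (m + r)) sizes ⟩
    2 * m * a + 2 * m * (m + r) ∎))))
    where
    lhs : ∀ m a k r → 2 * m * a + (2 * m * k + r) ≡ 2 * m * (a + k) + r
    lhs = solve-∀
    rhs : ∀ m t r → 2 * m * t + 2 * (2 * m * m) + 4 * m * r ≡ 2 * m * (m + t + r) + 2 * m * (m + r)
    rhs = solve-∀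
    -- For `r = 1` the extra 1 on the left makes the inequality strict, which excludes `k = m + 1`;
    -- for `r = 0` it gives `k ≤ m` outright.
    bound : ∀ r → r ≤ 1 → 2 * m * k + r ≤ 2 * m * (m + r) → 2 * m * k < 2 * m * suc m
    bound zero _ q = begin-strict
      2 * m * k ≡⟨ +-identityʳ _ ⟨
      2 * m * k + 0 ≤⟨ q ⟩
      2 * m * (m + 0) ≡⟨ cong (2 * m *_) (+-identityʳ m) ⟩
      2 * m * m <⟨ *-monoʳ-< (2 * m) {{>-nonZero (≤-trans 1≤m (m≤m+n m _))}} ≤-refl ⟩
      2 * m * suc m ∎
    bound (suc zero) _ q = begin
      suc (2 * m * k) ≡⟨ +-comm 1 _ ⟩
      2 * m * k + 1 ≤⟨ q ⟩
      2 * m * (m + 1) ≡⟨ cong (2 * m *_) (+-comm m 1) ⟩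
      2 * m * suc m ∎
    bound (suc (suc r)) (s≤s ()) q
  -- Everything is rewritten in the surpluses `p`, `q`, `r` and in `k′ = k - 2`. These are true
  -- differences, so the final inequality is polynomial in natural numbers without subtraction.
  p = m ∸ k
  q = t ∸ m
  k′ = k ∸ 2
  kk : k ≡ 2 + k′
  kk = sym (m+[n∸m]≡n 2≤k)
  mm : m ≡ 2 + k′ + p
  mm = trans (sym (m+[n∸m]≡n k≤m)) (cong (_+ p) kk)
  tt : t ≡ 2 + k′ + p + q
  tt = trans (sym (m+[n∸m]≡n m≤t)) (cong (_+ q) mm)
  aa : a ≡ 2 * (2 + k′) + (2 * p + q + r)
  aa = trans (sym sizes) (trans (cong₂ (λ x y → x + y + r) mm tt) (eq k′ p q r))
    where
    eq : ∀ k′ p q r → 2 + k′ + p + (2 + k′ + p + q) + r ≡ 2 * (2 + k′) + (2 * p + q + r)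
    eq = solve-∀
  δδ : δ ≡ 2 * p + q + r
  δδ = +-cancelˡ-≡ (2 * (2 + k′)) _ _ (trans (cong (λ x → 2 * x + δ) (sym kk)) (trans δ-def aa))
  hh : h ≡ 3 * (2 + k′) + (4 * p + 2 * q + 2 * r)
  hh = +-cancelʳ-≡ (2 + k′) _ _
    (trans (cong (h +_) (sym kk)) (trans h-def (trans (cong (2 *_) aa) (eq k′ p q r))))
    where
    eq : ∀ k′ p q r →
      2 * (2 * (2 + k′) + (2 * p + q + r)) ≡ 3 * (2 + k′) + (4 * p + 2 * q + 2 * r) + (2 + k′)
    eq = solve-∀
  -- The hypothesis `a < 4 * k` enters here: it says that `δ < 2 * k`.
  δ≤2m : δ ≤ 2 * m
  δ≤2m = ≤-trans (+-cancelˡ-≤ (2 * k) _ _ (begin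
    2 * k + δ ≡⟨ δ-def ⟩
    a ≤⟨ <⇒≤ a<4k ⟩
    4 * k ≡⟨ eq k ⟩
    2 * k + 2 * k ∎)) (*-monoʳ-≤ 2 k≤m)
    where
    eq : ∀ k → 4 * k ≡ 2 * k + 2 * k
    eq = solve-∀
  -- At most one low vertex costs at most δ; from the second one on, the arcs lost to disjoint
  -- out-neighbourhoods outweigh the missing degree δ ≤ 2 m.
  lows : ∀ l → e + l * m ≤ 2 * m * m + 2 * m → 2 * e + l * δ ≤ 4 * m * m + 2 * δ
  lows zero _ = begin
    2 * e + 0 ≡⟨ +-identityʳ _ ⟩
    2 * e ≤⟨ *-monoʳ-≤ 2 e≤ ⟩
    2 * (2 * m * m) ≡⟨ eq m ⟩
    4 * m * m ≤⟨ m≤m+n _ _ ⟩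
    4 * m * m + 2 * δ ∎
    where
    eq : ∀ m → 2 * (2 * m * m) ≡ 4 * m * m
    eq = solve-∀
  lows (suc zero) _ = begin
    2 * e + 1 * δ ≤⟨ +-mono-≤ (*-monoʳ-≤ 2 e≤) (*-monoˡ-≤ δ {1} {2} (s≤s z≤n)) ⟩
    2 * (2 * m * m) + 2 * δ ≡⟨ cong (_+ 2 * δ) (eq m) ⟩
    4 * m * m + 2 * δ ∎
    where
    eq : ∀ m → 2 * (2 * m * m) ≡ 4 * m * m
    eq = solve-∀
  lows (suc (suc l)) le = +-cancelʳ-≤ (4 * m + l * (2 * m)) _ _ (begin
    2 * e + (δ + (δ + l * δ)) + (4 * m + l * (2 * m)) ≡⟨ eq₁ e m l δ ⟩
    2 * (e + suc (suc l) * m) + 2 * δ + l * δ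
      ≤⟨ +-mono-≤ (+-monoˡ-≤ (2 * δ) (*-monoʳ-≤ 2 le)) (*-monoʳ-≤ l δ≤2m) ⟩
    2 * (2 * m * m + 2 * m) + 2 * δ + l * (2 * m) ≡⟨ eq₂ m l δ ⟩
    4 * m * m + 2 * δ + (4 * m + l * (2 * m)) ∎)
    where
    eq₁ : ∀ e m l δ →
      2 * e + (δ + (δ + l * δ)) + (4 * m + l * (2 * m)) ≡ 2 * (e + suc (suc l) * m) + 2 * δ + l * δ
    eq₁ = solve-∀
    eq₂ : ∀ m l δ →
      2 * (2 * m * m + 2 * m) + 2 * δ + l * (2 * m) ≡ 4 * m * m + 2 * δ + (4 * m + l * (2 * m))
    eq₂ = solve-∀
  raw : 2 * m * h + r ≤ 2 * m * t + 4 * m * m + 4 * m * r + 2 * δ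
  raw = begin
    2 * m * h + r ≤⟨ I₂ ⟩
    2 * m * t + 2 * e + 4 * m * r + l * δ ≡⟨ eq (2 * m * t) (2 * e) (4 * m * r) (l * δ) ⟩
    2 * m * t + 4 * m * r + (2 * e + l * δ) ≤⟨ +-monoʳ-≤ (2 * m * t + 4 * m * r) (lows l le≤) ⟩
    2 * m * t + 4 * m * r + (4 * m * m + 2 * δ) ≡⟨ eq′ (2 * m * t) (4 * m * r) (4 * m * m) (2 * δ) ⟩
    2 * m * t + 4 * m * m + 4 * m * r + 2 * δ ∎
    where
    eq : ∀ x y z w → x + y + z + w ≡ x + z + (y + w)
    eq = solve-∀
    eq′ : ∀ x y z w → x + y + (z + w) ≡ x + z + y + w
    eq′ = solve-∀
  -- After cancellation of `common`, the required degrees exceed the available arcs by the left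
  -- side, to be paid for by `r ≤ 1`. As the left side is even, it vanishes, which forces `q = 0`
  -- and then `p = 0`.
  small : 2 * ((k′ + p) * (p + q) + q) ≤ r
  small = +-cancelʳ-≤ (common k′ p q r) _ _ (begin
    2 * ((k′ + p) * (p + q) + q) + common k′ p q r ≡⟨ eq₁ k′ p q r ⟨
    2 * (2 + k′ + p) * (3 * (2 + k′) + (4 * p + 2 * q + 2 * r)) + r
      ≡⟨ cong₂ (λ x y → 2 * x * y + r) mm hh ⟨
    2 * m * h + r ≤⟨ raw ⟩
    2 * m * t + 4 * m * m + 4 * m * r + 2 * δ
      ≡⟨ cong₂ (λ x y → 2 * m * x + 4 * m * m + 4 * m * r + 2 * y) tt δδ ⟩
    2 * m * (2 + k′ + p + q) + 4 * m * m + 4 * m * r + 2 * (2 * p + q + r)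
      ≡⟨ cong (λ x → 2 * x * (2 + k′ + p + q) + 4 * x * x + 4 * x * r + 2 * (2 * p + q + r)) mm ⟩
    2 * (2 + k′ + p) * (2 + k′ + p + q) + 4 * (2 + k′ + p) * (2 + k′ + p) + 4 * (2 + k′ + p) * r + 2 *
      (2 * p + q + r)
      ≡⟨ eq₂ k′ p q r ⟩
    r + common k′ p q r ∎)
    where
    common : ℕ → ℕ → ℕ → ℕ → ℕ
    common k′ p q r = 2 * (2 + k′ + p) * (3 * (2 + k′) + (3 * p + q + 2 * r)) + 2 * (2 * p + q) + r
    eq₁ : ∀ k′ p q r → 2 * (2 + k′ + p) * (3 * (2 + k′) + (4 * p + 2 * q + 2 * r)) + r
        ≡ 2 * ((k′ + p) * (p + q) + q) +
          (2 * (2 + k′ + p) * (3 * (2 + k′) + (3 * p + q + 2 * r)) + 2 * (2 * p + q) + r)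
    eq₁ = solve-∀
    eq₂ : ∀ k′ p q r →
      2 * (2 + k′ + p) * (2 + k′ + p + q) + 4 * (2 + k′ + p) * (2 + k′ + p) + 4 * (2 + k′ + p) * r + 2 *
      (2 * p + q + r)
        ≡ r + (2 * (2 + k′ + p) * (3 * (2 + k′) + (3 * p + q + 2 * r)) + 2 * (2 * p + q) + r)
    eq₂ = solve-∀
  zero′ : (k′ + p) * (p + q) + q ≡ 0
  zero′ = vanish _ (≤-trans small r≤1)
    where
    vanish : ∀ x → 2 * x ≤ 1 → x ≡ 0
    vanish zero _ = refl
    vanish (suc x) (s≤s b) = contradiction (subst (_≤ 0) (+-suc x _) b) λ ()
  q≡0 : q ≡ 0
  q≡0 = m+n≡0⇒n≡0 ((k′ + p) * (p + q)) zero′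
  p≡0 : p ≡ 0
  p≡0 = case m*n≡0⇒m≡0∨n≡0 (k′ + p) (m+n≡0⇒m≡0 _ zero′) of λ
    { (inj₁ e) → m+n≡0⇒n≡0 k′ e
    ; (inj₂ e) → m+n≡0⇒m≡0 p e }
  m≡k : m ≡ k
  m≡k = trans mm (trans (cong (2 + k′ +_) p≡0) (trans (+-identityʳ _) (sym kk)))
  t≡k : t ≡ k
  t≡k = trans tt
    (trans (cong₂ (λ x y → 2 + k′ + x + y) p≡0 q≡0)
    (trans (+-identityʳ _) (trans (+-identityʳ _) (sym kk))))

-- Counting arcs in bipartite digraphs

module Bipartite {n : ℕ} (E : Fin n → Fin n → Bool) (side : Fin n → Bool)
  (bip : ∀ u v → E u v ≡ true → side v ≡ not (side u)) where

  opp same : Fin n → Fin n → Bool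
  opp u v = side u xor side v
  same u v = not (side u) xor side v

  flip⇒opp : ∀ u v → side v ≡ not (side u) → opp u v ≡ true
  flip⇒opp u v e with side u | side v | e
  ... | true  | _ | refl = refl
  ... | false | _ | refl = refl

  E⇒opp : ∀ u v → E u v ≡ true → opp u v ≡ true
  E⇒opp u v e = flip⇒opp u v (bip u v e)

  ιE≤ιopp : ∀ u v → ι (E u v) ≤ ι (opp u v)
  ιE≤ιopp u v with E u v in e
  ... | false = z≤n
  ... | true rewrite E⇒opp u v e = ≤-refl

  opp-sym : ∀ u v → opp u v ≡ opp v u
  opp-sym u v = Bool.xor-comm (side u) (side v)

  outdegree indegree degree : Fin n → ℕ
  outdegree u = ∑[ v < n ] ι (E u v)
  indegree u = ∑[ v < n ] ι (E v u)
  degree u = outdegree u + indegree u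

  cnt : (Fin n → Fin n → Bool) → (Fin n → Bool) → (Fin n → Bool) → ℕ
  cnt K S T = ∑[ u < n ] ∑[ v < n ] ι (S u ∧ T v ∧ K u v)

  -- Each of the two sides contains `m` vertices of `S`. The side is selected by a Boolean, so that
  -- `b = side u` counts the vertices of `S` opposite `u`, and `b = not (side u)` those beside `u`,
  -- without a case distinction.
  Sized : (Fin n → Bool) → ℕ → Set
  Sized S m = ∀ b → ∣ (λ v → S v ∧ (b xor side v)) ∣ ≡ m

  outdegree≤ : ∀ {a} → Sized (λ _ → true) a → ∀ u → outdegree u ≤ a
  outdegree≤ balanced u = ≤-trans (sum-mono (ιE≤ιopp u)) (≤-reflexive (balanced (side u)))

  indegree≤ : ∀ {a} → Sized (λ _ → true) a → ∀ u → indegree u ≤ a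
  indegree≤ balanced u =
    ≤-trans (sum-mono λ v → ≤-trans (ιE≤ιopp v u) (≤-reflexive (cong ι (opp-sym v u))))
    (≤-reflexive (balanced (side u)))

  sized-∣∣ : ∀ S {m} → Sized S m → ∣ S ∣ ≡ 2 * m
  sized-∣∣ S {m} s = begin
    ∣ S ∣ ≡⟨ sum-cong-≗ split ⟩
    ∑[ v < n ] (ι (S v ∧ (true xor side v)) + ι (S v ∧ (false xor side v)))
      ≡⟨ ∑-distrib-+ (λ v → ι (S v ∧ (true xor side v))) (λ v → ι (S v ∧ (false xor side v))) ⟩
    ∣ (λ v → S v ∧ (true xor side v)) ∣ + ∣ (λ v → S v ∧ (false xor side v)) ∣
      ≡⟨ cong₂ _+_ (s true) (s false) ⟩
    m + m ≡⟨ cong (m +_) (+-identityʳ m) ⟨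
    2 * m ∎
    where
    open ≡-Reasoning
    split : ∀ v → ι (S v) ≡ ι (S v ∧ (true xor side v)) + ι (S v ∧ (false xor side v))
    split v with S v | side v
    ... | true  | true  = refl
    ... | true  | false = refl
    ... | false | _     = refl

  cnt-xor : ∀ (f : Fin n → Bool) P Q {m} → Sized Q m → cnt (λ u v → f u xor side v) P Q ≡ ∣ P ∣ * m
  cnt-xor f P Q {m} s = trans (sum-cong-≗ inner) (sym (*-distribʳ-sum m (ι ∘ P)))
    where
    inner : ∀ u → ∑[ v < n ] ι (P u ∧ Q v ∧ (f u xor side v)) ≡ ι (P u) * m
    inner u with P u
    ... | false = sum-zero n
    ... | true  = trans (s (f u)) (sym (+-identityʳ m))

  cnt-opp : ∀ P Q {m} → Sized Q m → cnt opp P Q ≡ ∣ P ∣ * m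
  cnt-opp = cnt-xor side

  cnt-same : ∀ P Q {m} → Sized Q m → cnt same P Q ≡ ∣ P ∣ * m
  cnt-same = cnt-xor (not ∘ side)

  cnt-E≤opp : ∀ P Q → cnt E P Q ≤ cnt opp P Q
  cnt-E≤opp P Q = sum-mono λ u → sum-mono λ v → le u v
    where
    le : ∀ u v → ι (P u ∧ Q v ∧ E u v) ≤ ι (P u ∧ Q v ∧ opp u v)
    le u v with P u | Q v
    ... | true  | true  = ιE≤ιopp u v
    ... | true  | false = z≤n
    ... | false | _     = z≤n

  cnt-missing : ∀ P Q u v → P u ≡ true → Q v ≡ true → opp u v ≡ true → E u v ≡ false →
    cnt E P Q + 1 ≤ cnt opp P Q
  cnt-missing P Q u v Pu Qv o ¬e = sum-mono-at 1 (λ u → sum-mono (le u)) u (sum-mono-at 1 (le u) v at)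
    where
    le : ∀ u v → ι (P u ∧ Q v ∧ E u v) ≤ ι (P u ∧ Q v ∧ opp u v)
    le u v with P u | Q v
    ... | true  | true  = ιE≤ιopp u v
    ... | true  | false = z≤n
    ... | false | _     = z≤n
    at : ι (P u ∧ Q v ∧ E u v) + 1 ≤ ι (P u ∧ Q v ∧ opp u v)
    at rewrite Pu | Qv | o | ¬e = ≤-refl

  degree-split : ∀ S T R → (∀ v → ι (S v) + ι (T v) + ι (R v) ≡ 1) →
    ∑[ u < n ] (ι (S u) * degree u) ≡
      (cnt E S S + cnt E S T + cnt E S R) + (cnt E S S + cnt E T S + cnt E R S)
  degree-split S T R part = begin
    ∑[ u < n ] (ι (S u) * degree u)
      ≡⟨ sum-cong-≗ (λ u → *-distribˡ-+ (ι (S u)) (outdegree u) (indegree u)) ⟩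
    ∑[ u < n ] (ι (S u) * outdegree u + ι (S u) * indegree u)
      ≡⟨ ∑-distrib-+ (λ u → ι (S u) * outdegree u) (λ u → ι (S u) * indegree u) ⟩
    ∑[ u < n ] (ι (S u) * outdegree u) + ∑[ u < n ] (ι (S u) * indegree u) ≡⟨ cong₂ _+_ outs inns ⟩
    (cnt E S S + cnt E S T + cnt E S R) + (cnt E S S + cnt E T S + cnt E R S) ∎
    where
    open ≡-Reasoning
    three : (f g h : Fin n → ℕ) → ∑[ v < n ] (f v + g v + h v) ≡ sum f + sum g + sum h
    three f g h = trans (∑-distrib-+ (λ v → f v + g v) h) (cong (_+ sum h) (∑-distrib-+ f g))
    term : ∀ v (c : Bool → Bool) → c false ≡ false → ι (c true) ≡ ι (c (S v)) + ι (c (T v)) + ι (c (R v))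
    term v c cf with S v | T v | R v | part v
    ... | true | false | false | _ rewrite cf = sym (trans (+-identityʳ _) (+-identityʳ _))
    ... | false | true | false | _ rewrite cf = sym (+-identityʳ _)
    ... | false | false | true | _ rewrite cf = refl
    term v c cf | true | true | _ | ()
    term v c cf | true | false | true | ()
    term v c cf | false | true | true | ()
    term v c cf | false | false | false | ()
    ι* : ∀ b c → ι b * ι c ≡ ι (b ∧ c)
    ι* true  c = +-identityʳ _
    ι* false c = refl
    outs : ∑[ u < n ] (ι (S u) * outdegree u) ≡ cnt E S S + cnt E S T + cnt E S R
    outs = begin
      ∑[ u < n ] (ι (S u) * outdegree u)
        ≡⟨ sum-cong-≗ (λ u → *-distribˡ-sum (ι (S u)) (λ v → ι (E u v))) ⟩
      ∑[ u < n ] ∑[ v < n ] (ι (S u) * ι (E u v))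
        ≡⟨ sum-cong-≗
        (λ u → sum-cong-≗ λ v →
        trans (ι* (S u) (E u v)) (term v (λ b → S u ∧ b ∧ E u v) (Bool.∧-zeroʳ _))) ⟩
      ∑[ u < n ] ∑[ v < n ] (ι (S u ∧ S v ∧ E u v) + ι (S u ∧ T v ∧ E u v) + ι (S u ∧ R v ∧ E u v))
        ≡⟨ sum-cong-≗
          (λ u → three (λ v → ι (S u ∧ S v ∧ E u v)) (λ v → ι (S u ∧ T v ∧ E u v))
          (λ v → ι (S u ∧ R v ∧ E u v))) ⟩
      ∑[ u < n ] (∑[ v < n ] ι (S u ∧ S v ∧ E u v) + ∑[ v < n ] ι (S u ∧ T v ∧ E u v)
        + ∑[ v < n ] ι (S u ∧ R v ∧ E u v))
        ≡⟨ three (λ u → ∑[ v < n ] ι (S u ∧ S v ∧ E u v)) (λ u → ∑[ v < n ] ι (S u ∧ T v ∧ E u v))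
          (λ u → ∑[ v < n ] ι (S u ∧ R v ∧ E u v)) ⟩
      cnt E S S + cnt E S T + cnt E S R ∎
    inns : ∑[ u < n ] (ι (S u) * indegree u) ≡ cnt E S S + cnt E T S + cnt E R S
    inns = begin
      ∑[ u < n ] (ι (S u) * indegree u)
        ≡⟨ sum-cong-≗ (λ u → *-distribˡ-sum (ι (S u)) (λ v → ι (E v u))) ⟩
      ∑[ u < n ] ∑[ v < n ] (ι (S u) * ι (E v u)) ≡⟨ ∑-comm (λ u v → ι (S u) * ι (E v u)) ⟩
      ∑[ v < n ] ∑[ u < n ] (ι (S u) * ι (E v u))
        ≡⟨ sum-cong-≗
        (λ v → sum-cong-≗ λ u → trans (ι* (S u) (E v u)) (term v (λ b → b ∧ S u ∧ E v u) refl)) ⟩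
      ∑[ v < n ] ∑[ u < n ] (ι (S v ∧ S u ∧ E v u) + ι (T v ∧ S u ∧ E v u) + ι (R v ∧ S u ∧ E v u))
        ≡⟨ sum-cong-≗
          (λ v → three (λ u → ι (S v ∧ S u ∧ E v u)) (λ u → ι (T v ∧ S u ∧ E v u))
          (λ u → ι (R v ∧ S u ∧ E v u))) ⟩
      ∑[ v < n ] (∑[ u < n ] ι (S v ∧ S u ∧ E v u) + ∑[ u < n ] ι (T v ∧ S u ∧ E v u)
        + ∑[ u < n ] ι (R v ∧ S u ∧ E v u))
        ≡⟨ three (λ v → ∑[ u < n ] ι (S v ∧ S u ∧ E v u)) (λ v → ∑[ u < n ] ι (T v ∧ S u ∧ E v u))
          (λ v → ∑[ u < n ] ι (R v ∧ S u ∧ E v u)) ⟩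
      cnt E S S + cnt E T S + cnt E R S ∎

  -- Each vertex receives at most one arc from a low vertex, so the low vertices of `S` together
  -- send at most `∣ S ∣ = 2m` arcs into `S`, although each has `m` possible targets there. The
  -- pointwise inequality adds these possible targets on the left and the arcs from low vertices on
  -- the right.
  low-arcs : ∀ (low : Fin n → Bool) S {m} → Sized S m →
    (∀ u v w → low u ≡ true → low v ≡ true → E u w ≡ true → E v w ≡ true → u ≡ v) →
    cnt E S S + ∣ (λ u → S u ∧ low u) ∣ * m ≤ 2 * m * m + 2 * m
  low-arcs low S {m} s uniq = begin
    cnt E S S + ∣ (λ u → S u ∧ low u) ∣ * m ≡⟨ cong (cnt E S S +_) (cnt-opp (λ u → S u ∧ low u) S s) ⟨
    cnt E S S + cnt opp (λ u → S u ∧ low u) S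
      ≡⟨ dist (λ u w → ι (S u ∧ S w ∧ E u w)) (λ u w → ι ((S u ∧ low u) ∧ S w ∧ opp u w)) ⟨
    ∑[ u < n ] ∑[ w < n ] (ι (S u ∧ S w ∧ E u w) + ι ((S u ∧ low u) ∧ S w ∧ opp u w))
      ≤⟨ sum-mono (λ u → sum-mono λ w → le u w) ⟩
    ∑[ u < n ] ∑[ w < n ] (ι (S u ∧ S w ∧ opp u w) + ι (S w) * ι (low u ∧ E u w))
      ≡⟨ dist (λ u w → ι (S u ∧ S w ∧ opp u w)) (λ u w → ι (S w) * ι (low u ∧ E u w)) ⟩
    cnt opp S S + ∑[ u < n ] ∑[ w < n ] (ι (S w) * ι (low u ∧ E u w))
      ≡⟨ cong (cnt opp S S +_) (∑-comm (λ u w → ι (S w) * ι (low u ∧ E u w))) ⟩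
    cnt opp S S + ∑[ w < n ] ∑[ u < n ] (ι (S w) * ι (low u ∧ E u w))
      ≤⟨ +-monoʳ-≤ (cnt opp S S) (sum-mono atMost) ⟩
    cnt opp S S + ∣ S ∣
      ≡⟨ cong₂ _+_ (trans (cnt-opp S S s) (cong (_* m) (sized-∣∣ S s))) (sized-∣∣ S s) ⟩
    2 * m * m + 2 * m ∎
    where
    open ≤-Reasoning
    dist : (f g : Fin n → Fin n → ℕ) →
      ∑[ u < n ] ∑[ w < n ] (f u w + g u w) ≡ ∑[ u < n ] ∑[ w < n ] f u w + ∑[ u < n ] ∑[ w < n ] g u w
    dist f g = trans (sum-cong-≗ λ u → ∑-distrib-+ (f u) (g u))
      (∑-distrib-+ (λ u → sum (f u)) (λ u → sum (g u)))
    le : ∀ u w → ι (S u ∧ S w ∧ E u w) + ι ((S u ∧ low u) ∧ S w ∧ opp u w)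
       ≤ ι (S u ∧ S w ∧ opp u w) + ι (S w) * ι (low u ∧ E u w)
    le u w with S u | S w | low u
    ... | false | _     | _ = z≤n
    ... | true  | false | true  = z≤n
    ... | true  | false | false = z≤n
    ... | true  | true  | false =
      ≤-trans (≤-reflexive (+-identityʳ _)) (≤-trans (ιE≤ιopp u w) (m≤m+n _ _))
    ... | true  | true  | true  =
      ≤-reflexive (trans (+-comm (ι (E u w)) _) (cong (ι (opp u w) +_) (sym (+-identityʳ _))))
    atMost : ∀ w → ∑[ u < n ] (ι (S w) * ι (low u ∧ E u w)) ≤ ι (S w)
    atMost w with S w
    ... | false = ≤-reflexive (sum-zero n)
    ... | true  =
      ≤-trans (≤-reflexive (sum-cong-≗ λ u → +-identityʳ (ι (low u ∧ E u w))))
      (sum-unique (λ u → low u ∧ E u w) λ u v lu lv →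
      case ∧-split (low u) (E u w) lu of λ
      { (a , b) → case ∧-split (low v) (E v w) lv of λ { (c , d) → uniq u v w a c b d } })

  -- Both sums are reindexed along N, so that each unmergeable pair u ∈ S, v ∈ T on the same
  -- side accounts for at most one of the arcs u → N v and v → N u.
  crossing-arcs : ∀ {N : Fin n → Fin n} → Injective _≡_ _≡_ N → (∀ v → side (N v) ≡ not (side v)) →
    ∀ S T → (∀ v → S (N v) ≡ S v) → (∀ v → T (N v) ≡ T v) →
    (∀ u v → S u ≡ true → T v ≡ true → E u (N v) ≡ true → E v (N u) ≡ true → ⊥) →
    cnt E S T + cnt E T S ≤ cnt same S T
  crossing-arcs {N} inj flips S T SN TN unmergeable = begin
    cnt E S T + cnt E T S
      ≡⟨ cong₂ _+_ (sum-cong-≗ λ u →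
      trans (sum-reindex inj (λ v → ι (S u ∧ T v ∧ E u v)))
      (sum-cong-≗ λ v → cong (λ t → ι (S u ∧ t ∧ E u (N v))) (TN v)))
                             (trans (sum-cong-≗ λ v →
                               trans (sum-reindex inj (λ u → ι (T v ∧ S u ∧ E v u)))
                               (sum-cong-≗ λ u → cong (λ t → ι (T v ∧ t ∧ E v (N u))) (SN u)))
                               (∑-comm (λ v u → ι (T v ∧ S u ∧ E v (N u))))) ⟩
    ∑[ u < n ] ∑[ v < n ] ι (S u ∧ T v ∧ E u (N v)) + ∑[ u < n ] ∑[ v < n ] ι (T v ∧ S u ∧ E v (N u))
      ≡⟨ ∑-distrib-+ (λ u → ∑[ v < n ] ι (S u ∧ T v ∧ E u (N v)))
        (λ u → ∑[ v < n ] ι (T v ∧ S u ∧ E v (N u))) ⟨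
    ∑[ u < n ] (∑[ v < n ] ι (S u ∧ T v ∧ E u (N v)) + ∑[ v < n ] ι (T v ∧ S u ∧ E v (N u)))
      ≡⟨ sum-cong-≗
        (λ u → ∑-distrib-+ (λ v → ι (S u ∧ T v ∧ E u (N v))) (λ v → ι (T v ∧ S u ∧ E v (N u)))) ⟨
    ∑[ u < n ] ∑[ v < n ] (ι (S u ∧ T v ∧ E u (N v)) + ι (T v ∧ S u ∧ E v (N u)))
      ≤⟨ sum-mono (λ u → sum-mono λ v → le u v) ⟩
    cnt same S T ∎
    where
    open ≤-Reasoning
    to-same : ∀ u v → E u (N v) ≡ true → same u v ≡ true
    to-same u v e with side u | side v | side (N v) | flips v | bip u (N v) e
    ... | true  | true  | _ | refl | _ = refl
    ... | false | false | _ | refl | _ = refl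
    to-same′ : ∀ u v → E v (N u) ≡ true → same u v ≡ true
    to-same′ u v e with side u | side v | side (N u) | flips u | bip v (N u) e
    ... | true  | true  | _ | refl | _ = refl
    ... | false | false | _ | refl | _ = refl
    le : ∀ u v → ι (S u ∧ T v ∧ E u (N v)) + ι (T v ∧ S u ∧ E v (N u)) ≤ ι (S u ∧ T v ∧ same u v)
    le u v with S u in Su | T v in Tv | E u (N v) in e | E v (N u) in e′
    ... | false | false | _ | _ = z≤n
    ... | false | true | _ | _ = z≤n
    ... | true | false | _ | _ = z≤n
    ... | true | true | false | false = z≤n
    ... | true | true | true | true = ⊥-elim (unmergeable u v Su Tv e e′)
    ... | true | true | true | false rewrite to-same u v e = ≤-refl
    ... | true | true | false | true rewrite to-same′ u v e′ = ≤-refl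

-- Orbits

swap : Fin n → Fin n → Fin n → Fin n
swap p q w with w ≟ p | w ≟ q
... | yes _ | _     = q
... | no _  | yes _ = p
... | no _  | no _  = w

swap-left : (p q : Fin n) → swap p q p ≡ q
swap-left p q with p ≟ p | p ≟ q
... | yes _ | _ = refl
... | no ¬p | _ = contradiction refl ¬p

swap-right : (p q : Fin n) → swap p q q ≡ p
swap-right p q with q ≟ p | q ≟ q
... | yes e | _     = e
... | no _  | yes _ = refl
... | no _  | no ¬q = contradiction refl ¬q

swap-other : (p q : Fin n) {w : Fin n} → ¬ (w ≡ p) → ¬ (w ≡ q) → swap p q w ≡ w
swap-other p q {w} w≢p w≢q with w ≟ p | w ≟ q
... | yes e | _     = contradiction e w≢p
... | no _  | yes e = contradiction e w≢q
... | no _  | no _  = refl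

swap-involutive : (p q w : Fin n) → swap p q (swap p q w) ≡ w
swap-involutive p q w = case w ≟ p of λ
  { (yes refl) → trans (cong (swap p q) (swap-left p q)) (swap-right p q)
  ; (no w≢p) → case w ≟ q of λ
    { (yes refl) → trans (cong (swap p q) (swap-right p q)) (swap-left p q)
    ; (no w≢q) → trans (cong (swap p q) (swap-other p q w≢p w≢q)) (swap-other p q w≢p w≢q) } }

swap-injective : (p q : Fin n) → Injective _≡_ _≡_ (swap p q)
swap-injective p q {v} {w} e =
  trans (sym (swap-involutive p q v)) (trans (cong (swap p q) e) (swap-involutive p q w))

swap-preserves : {A : Set} (f : Fin n → A) (p q : Fin n) → f p ≡ f q → ∀ w → f (swap p q w) ≡ f w
swap-preserves f p q e w with w ≟ p | w ≟ q
... | yes refl | _        = sym e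
... | no _     | yes refl = e
... | no _     | no _     = refl

-- For injective `N` this makes `S` the vertex set of a single cycle of `N`. It is phrased by walks
-- into a root because, after successors are exchanged, such a walk can be followed unchanged up to
-- the first altered vertex.
record Orbit {n} (N : Fin n → Fin n) (S : Fin n → Bool) : Set where
  field
    closed : ∀ v → S v ≡ true → S (N v) ≡ true
    root   : Fin n
    root∈  : S root ≡ true
    reach  : ∀ v → S v ≡ true → ∃ λ i → iterate N v i ≡ root

  closed-iterate : ∀ i v → S v ≡ true → S (iterate N v i) ≡ true
  closed-iterate zero    v v∈ = v∈
  closed-iterate (suc i) v v∈ = closed-iterate i (N v) (closed v v∈)

module _ {N : Fin n → Fin n} (inj : Injective _≡_ _≡_ N) where

  open Orbit

  -- Since `N` permutes a finite set, `v` is an iterate of `N v`, so forward closure also carries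
  -- membership backwards.
  closed-back : ∀ (S : Fin n → Bool) → (∀ v → S v ≡ true → S (N v) ≡ true) → ∀ v → S (N v) ≡ S v
  closed-back S cl v with S v in Sv | S (N v) in SNv
  ... | true  | true  = refl
  ... | false | false = refl
  ... | true  | false = true≢false (cl v Sv) SNv
  ... | false | true with p , _ , e ← period inj v =
    true≢false (trans (cong S (sym e)) (go p (N v) SNv)) Sv
    where
    go : ∀ i w → S w ≡ true → S (iterate N w i) ≡ true
    go zero    w w∈ = w∈
    go (suc i) w w∈ = go i (N w) (cl w w∈)

  iterate-multiple : ∀ {r} p → iterate N r p ≡ r → ∀ j → iterate N r (j * p) ≡ r
  iterate-multiple p e zero = refl
  iterate-multiple {r} p e (suc j) =
    trans (iterate-+ N r p (j * p)) (trans (cong (λ x → iterate N x (j * p)) e) (iterate-multiple p e j))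

  reroot : ∀ {S} (O : Orbit N S) r → S r ≡ true → Orbit N S
  reroot O r r∈ .closed = closed O
  reroot O r r∈ .root   = r
  reroot O r r∈ .root∈  = r∈
  reroot {S} O r r∈ .reach v v∈ with reach O v v∈ | reach O r r∈ | period inj r
  -- The first `i` steps lead to the common root, which lies `j` steps past `r`; the other `j * p`
  -- steps complete `j` periods of length `suc p`.
  ... | i , ei | j , ej | p , _ , ep = i + j * p , (begin
    iterate N v (i + j * p)             ≡⟨ iterate-+ N v i (j * p) ⟩
    iterate N (iterate N v i) (j * p)   ≡⟨ cong (λ x → iterate N x (j * p)) (trans ei (sym ej)) ⟩
    iterate N (iterate N r j) (j * p)   ≡⟨ iterate-+ N r j (j * p) ⟨
    iterate N r (j + j * p)             ≡⟨ cong (iterate N r) (*-suc j p) ⟨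
    iterate N r (j * suc p)             ≡⟨ iterate-multiple (suc p) ep j ⟩
    r ∎)
    where open ≡-Reasoning

  abstract
    -- Limiting the search to `n` steps makes membership decidable and loses nothing, because
    -- periods are at most `n`.
    reaches? : ∀ r w → Dec (∃ λ (i : Fin (suc n)) → iterate N w (toℕ i) ≡ r)
    reaches? r w = any? λ i → iterate N w (toℕ i) ≟ r

    orbitOf : Fin n → Fin n → Bool
    orbitOf r w = does (reaches? r w)

    orbitOf-self : ∀ r → orbitOf r r ≡ true
    orbitOf-self r = dec-true (reaches? r r) (Fin.zero , refl)

    orbitOf-orbit : ∀ r → Orbit N (orbitOf r)
    orbitOf-orbit r .root = r
    orbitOf-orbit r .root∈ = orbitOf-self r
    orbitOf-orbit r .reach v v∈ with i , e ← does⇒ (reaches? r v) v∈ = toℕ i , e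
    orbitOf-orbit r .closed v v∈ with does⇒ (reaches? r v) v∈
    ... | Fin.suc i , e =
      dec-true (reaches? r (N v)) (Fin.inject₁ i , trans (cong (iterate N (N v)) (Fin.toℕ-inject₁ i)) e)
    -- Here `v` is `r` itself, and `N v` comes back after the remaining steps of a period.
    ... | Fin.zero , refl with p , p<n , e ← period inj v =
      dec-true (reaches? r (N v))
        (Fin.fromℕ< (m<n⇒m<1+n p<n) , trans (cong (iterate N (N v)) (Fin.toℕ-fromℕ< (m<n⇒m<1+n p<n))) e)

  -- The least positive period is `suc pred`; leastness makes the first `suc pred` iterates of `r`
  -- distinct.
  record Period (r : Fin n) : Set where
    field
      pred   : ℕ
      return : iterate N r (suc pred) ≡ r
      least  : ∀ i → i < pred → ¬ (iterate N r (suc i) ≡ r)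

    distinct< : ∀ i j → i < j → j < suc pred → ¬ (iterate N r i ≡ iterate N r j)
    distinct< i j i<j j≤ e with m≤n⇒∃[o]m+o≡n i<j
    ... | d , refl = least d (≤-trans (s≤s (m≤n+m d i)) (s≤s⁻¹ j≤))
      (sym (iterate-cancel inj i (suc d) (trans e (cong (iterate N r) (sym (+-suc i d))))))

    distinct : ∀ i j → i < suc pred → j < suc pred → iterate N r i ≡ iterate N r j → i ≡ j
    distinct i j i< j< e with <-cmp i j
    ... | tri< i<j _ _ = contradiction e (distinct< i j i<j j<)
    ... | tri≈ _ i≡j _ = i≡j
    ... | tri> _ _ j<i = contradiction (sym e) (distinct< j i j<i i<)

    reduce : ∀ i → ∃ λ j → j < suc pred × iterate N r j ≡ iterate N r i
    reduce zero = zero , s≤s z≤n , refl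
    reduce (suc i) with reduce i
    ... | j , j< , e with j <? pred
    ...   | yes j<p =
      suc j , s≤s j<p , trans (iterate-suc N r j) (trans (cong N e) (sym (iterate-suc N r i)))
    ...   | no ¬j<p = zero , s≤s z≤n , sym (begin
      iterate N r (suc i)    ≡⟨ iterate-suc N r i ⟩
      N (iterate N r i)      ≡⟨ cong N e ⟨
      N (iterate N r j)      ≡⟨ cong (λ x → N (iterate N r x)) (≤-antisym (s≤s⁻¹ j<) (≮⇒≥ ¬j<p)) ⟩
      N (iterate N r pred)   ≡⟨ iterate-suc N r pred ⟨
      iterate N r (suc pred) ≡⟨ return ⟩
      r ∎)
      where open ≡-Reasoning

  abstract
    least-period : ∀ r → Period r
    least-period r with p , _ , e ← period inj r =
      search p 0 (trans (cong (λ x → iterate N r (suc x)) (+-identityʳ p)) e) (λ _ ())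
      where
      search : ∀ f i → iterate N r (suc (f + i)) ≡ r → (∀ j → j < i → ¬ (iterate N r (suc j) ≡ r)) →
        Period r
      search zero i e small = record { pred = i ; return = e ; least = small }
      search (suc f) i e small with iterate N r (suc i) ≟ r
      ... | yes e′ = record { pred = i ; return = e′ ; least = small }
      ... | no ¬e = search f (suc i) (trans (cong (λ x → iterate N r (suc x)) (+-suc f i)) e) λ j j≤i →
        case m≤n⇒m<n∨m≡n (s≤s⁻¹ j≤i) of λ { (inj₁ j<i) → small j j<i ; (inj₂ refl) → ¬e }

  module PeriodTraversal {S} (O : Orbit N S) {r} (r∈ : S r ≡ true) (P : Period r) where

    private
      module P = Period P
      p = suc P.pred
      c : Fin p → Fin n
      c i = iterate N r (toℕ i)

    hits : ∀ w → S w ≡ true → ∃ λ (i : Fin p) → c i ≡ w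
    hits w w∈ with i , e ← reach (reroot O w w∈) r r∈ with j , j< , e′ ← P.reduce i =
      Fin.fromℕ< j< , trans (cong (iterate N r) (Fin.toℕ-fromℕ< j<)) (trans e′ e)

    -- A vertex of `S` is reached from `r` within one period, and only once by `distinct`. Counting
    -- the pairs of an index and a vertex in both orders then yields `size`.
    visits : ∀ w → ∑[ i < p ] ι (c i == w) ≡ ι (S w)
    visits w with S w in Sw
    ... | false =
      trans (sum-cong-≗ {p} λ i →
      cong ι (dec-false (c i ≟ w) λ { refl → true≢false (closed-iterate O (toℕ i) r r∈) Sw }))
      (sum-zero p)
    ... | true with i , refl ← hits w Sw = trans (sum-cong-≗ {p} same-index) (sum-==ʳ i)
      where
      same-index : ∀ j → ι (c j == c i) ≡ ι (i == j)
      same-index j with i ≟ j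
      ... | yes refl = cong ι (==-refl (c i))
      ... | no i≢j =
        cong ι (dec-false (c j ≟ c i) λ e →
        i≢j (sym (Fin.toℕ-injective (P.distinct (toℕ j) (toℕ i) (Fin.toℕ<n j) (Fin.toℕ<n i) e))))

    size : ∣ S ∣ ≡ p
    size = begin
      ∣ S ∣                             ≡⟨ sum-cong-≗ visits ⟨
      ∑[ w < n ] ∑[ i < p ] ι (c i == w) ≡⟨ ∑-comm (λ w i → ι (c i == w)) ⟩
      ∑[ i < p ] ∑[ w < n ] ι (c i == w) ≡⟨ sum-cong-≗ {p} (λ i → sum-==ʳ (c i)) ⟩
      ∑[ i < p ] 1                       ≡⟨ sum-const p 1 ⟩
      p * 1                              ≡⟨ *-identityʳ p ⟩
      p                                  ∎
      where open ≡-Reasoning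

    returns : iterate N r ∣ S ∣ ≡ r
    returns = trans (cong (iterate N r) size) P.return

    distinct : ∀ i j → i < ∣ S ∣ → j < ∣ S ∣ → iterate N r i ≡ iterate N r j → i ≡ j
    distinct i j i< j< = P.distinct i j (subst (i <_) size i<) (subst (j <_) size j<)

    index : ∀ w → S w ≡ true → ∃ λ i → i < ∣ S ∣ × iterate N r i ≡ w
    index w w∈ with i , e ← hits w w∈ = toℕ i , subst (toℕ i <_) (sym size) (Fin.toℕ<n i) , e

  module Traversal {S} (O : Orbit N S) r (r∈ : S r ≡ true) =
    PeriodTraversal O r∈ (least-period r)

  module Merge {A B} (OA : Orbit N A) (OB : Orbit N B) (disjoint : ∀ v → A v ≡ true → B v ≡ true → ⊥)
    (s t : Fin n) (s∈ : A s ≡ true) (t∈ : B t ≡ true) where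

    -- Exchanging the successors of `s` and `t` opens both cycles behind these vertices and splices
    -- them into one.
    merged : Fin n → Fin n
    merged = N ∘ swap s t

    merged-injective : Injective _≡_ _≡_ merged
    merged-injective = swap-injective s t ∘ inj

    private
      s→ : merged s ≡ N t
      s→ = cong N (swap-left s t)
      t→ : merged t ≡ N s
      t→ = cong N (swap-right s t)
      A→ : ∀ {v} → A v ≡ true → ¬ (v ≡ s) → merged v ≡ N v
      A→ v∈ v≢s = cong N (swap-other s t v≢s λ { refl → disjoint _ v∈ t∈ })
      B→ : ∀ {v} → B v ≡ true → ¬ (v ≡ t) → merged v ≡ N v
      B→ v∈ v≢t = cong N (swap-other s t (λ { refl → disjoint _ s∈ v∈ }) v≢t)

      reachA : ∀ i v → A v ≡ true → iterate N v i ≡ s → ∃ λ j → iterate merged v j ≡ s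
      reachA zero v v∈ e = 0 , e
      reachA (suc i) v v∈ e with v ≟ s
      ... | yes v≡s = 0 , v≡s
      ... | no v≢s with j , e′ ← reachA i (N v) (closed OA v v∈) e =
        suc j , trans (cong (λ x → iterate merged x j) (A→ v∈ v≢s)) e′

      reachB : ∀ i v → B v ≡ true → iterate N v i ≡ t → ∃ λ j → iterate merged v j ≡ t
      reachB zero v v∈ e = 0 , e
      reachB (suc i) v v∈ e with v ≟ t
      ... | yes v≡t = 0 , v≡t
      ... | no v≢t with j , e′ ← reachB i (N v) (closed OB v v∈) e =
        suc j , trans (cong (λ x → iterate merged x j) (B→ v∈ v≢t)) e′

      fromA : ∀ v → A v ≡ true → ∃ λ j → iterate merged v j ≡ s
      fromA v v∈ with i , e ← reach (reroot OA s s∈) v v∈ = reachA i v v∈ e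

    merged-orbit : Orbit merged (λ v → A v ∨ B v)
    merged-orbit .root = s
    merged-orbit .root∈ rewrite s∈ = refl
    merged-orbit .closed v v∈ = case v ≟ s of λ
      { (yes refl) → inB s→ (closed OB t t∈)
      ; (no v≢s) → case v ≟ t of λ
        { (yes refl) → inA t→ (closed OA s s∈)
        ; (no v≢t) → case ∨-split (A v) (B v) v∈ of λ
          { (inj₁ v∈A) → inA (A→ v∈A v≢s) (closed OA v v∈A)
          ; (inj₂ v∈B) → inB (B→ v∈B v≢t) (closed OB v v∈B) } } }
      where
      inA : ∀ {x y} → x ≡ y → A y ≡ true → A x ∨ B x ≡ true
      inA {x} refl x∈ rewrite x∈ = refl
      inB : ∀ {x y} → x ≡ y → B y ≡ true → A x ∨ B x ≡ true
      inB {x} refl x∈ rewrite x∈ = Bool.∨-zeroʳ (A x)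
    merged-orbit .reach v v∈ with A v in Av
    ... | true = fromA v Av
    -- A walk in `B` runs unchanged as far as `t`, whose new successor `N s` lies in `A`; from there
    -- the walk in `A` leads to `s`.
    ... | false with i , e ← reach (reroot OB t t∈) v v∈ with j , e′ ← reachB i v v∈ e
                with l , e″ ← fromA (N s) (closed OA s s∈) =
      j + suc l , (begin
        iterate merged v (j + suc l)             ≡⟨ iterate-+ merged v j (suc l) ⟩
        iterate merged (iterate merged v j) (suc l) ≡⟨ cong (λ x → iterate merged x (suc l)) e′ ⟩
        iterate merged (merged t) l              ≡⟨ cong (λ x → iterate merged x l) t→ ⟩
        iterate merged (N s) l                   ≡⟨ e″ ⟩
        s ∎)
      where open ≡-Reasoning

  conjugate-orbit : ∀ {S} (π : Fin n → Fin n) → (∀ v → π (π v) ≡ v) → (∀ v → S (π v) ≡ S v) →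
    Orbit N S → Orbit (π ∘ N ∘ π) S
  conjugate-orbit π inv Sπ O .root = π (root O)
  conjugate-orbit π inv Sπ O .root∈ = trans (Sπ _) (root∈ O)
  conjugate-orbit π inv Sπ O .closed v v∈ = trans (Sπ _) (closed O (π v) (trans (Sπ v) v∈))
  conjugate-orbit π inv Sπ O .reach v v∈ with i , e ← reach O (π v) (trans (Sπ v) v∈) =
    i , trans (conj i v) (cong π e)
    where
    conj : ∀ i v → iterate (π ∘ N ∘ π) v i ≡ π (iterate N (π v) i)
    conj zero v = sym (inv v)
    conj (suc i) v = trans (conj i (π (N (π v)))) (cong (λ x → π (iterate N x i)) (inv _))

∣∣-disjoint : (A B : Fin n → Bool) → (∀ v → A v ≡ true → B v ≡ true → ⊥) →
  ∣ (λ v → A v ∨ B v) ∣ ≡ ∣ A ∣ + ∣ B ∣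
∣∣-disjoint A B disjoint = trans (sum-cong-≗ pointwise) (∑-distrib-+ (ι ∘ A) (ι ∘ B))
  where
  pointwise : ∀ v → ι (A v ∨ B v) ≡ ι (A v) + ι (B v)
  pointwise v with A v in Av | B v in Bv
  ... | true  | true  = ⊥-elim (disjoint v Av Bv)
  ... | true  | false = refl
  ... | false | _     = refl

-- Consequences of the degree conditions

-- Here `h = 2a - k` is the larger threshold and `δ = a - 2k = h - (a + k)` the most by which a
-- vertex can fall short of it; equations replace the truncated subtractions. Of the hypothesis on
-- dominating pairs, one part has become a minimum degree for all vertices, and `dominating` keeps
-- the other. Strong connectivity appears in the form that every cut is crossed.
record Conditions {n} (E : Fin n → Fin n → Bool) (side : Fin n → Bool)
  (bip : ∀ u v → E u v ≡ true → side v ≡ not (side u)) (a k δ h : ℕ) : Set where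
  open Bipartite E side bip
  field
    balanced  : Sized (λ _ → true) a
    2≤k       : 2 ≤ k
    a<4k      : a < 4 * k
    δ-def     : 2 * k + δ ≡ a
    h-def     : h + k ≡ 2 * a
    minDegree : ∀ u → a + k ≤ degree u
    dominating : ∀ u v w → E u w ≡ true → E v w ≡ true → ¬ (u ≡ v) → h ≤ degree u ⊎ h ≤ degree v
    strong    : ∀ (S : Fin n → Bool) u v → S u ≡ true → S v ≡ false → ∃ λ x → ∃ λ y →
      S x ≡ true × S y ≡ false × E x y ≡ true

module Main {n} {E : Fin n → Fin n → Bool} {side : Fin n → Bool}
  {bip : ∀ u v → E u v ≡ true → side v ≡ not (side u)} {a k δ h : ℕ}
  (conditions : Conditions E side bip a k δ h) where

  open Bipartite E side bip public
  open Conditions conditions public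

  low : Fin n → Bool
  low u = does (degree u <? h)

  low⇒< : ∀ u → low u ≡ true → degree u < h
  low⇒< u = does⇒ (degree u <? h)

  ¬low⇒≥ : ∀ u → low u ≡ false → h ≤ degree u
  ¬low⇒≥ u e = ≮⇒≥ (¬does⇒ (degree u <? h) e)

  low-unique : ∀ u v w → low u ≡ true → low v ≡ true → E u w ≡ true → E v w ≡ true → u ≡ v
  low-unique u v w lu lv uw vw with u ≟ v
  ... | yes p = p
  ... | no p with dominating u v w uw vw p
  ...   | inj₁ q = contradiction q (<⇒≱ (low⇒< u lu))
  ...   | inj₂ q = contradiction q (<⇒≱ (low⇒< v lv))

  high-bound : ∀ u → h ≤ degree u + ι (low u) * δ
  high-bound u with low u in e
  ... | false = ≤-trans (¬low⇒≥ u e) (m≤m+n _ _)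
  ... | true = begin
    h ≡⟨ +-cancelʳ-≡ k _ _ (trans h-def (trans (cong (λ x → a + (x + 0)) (sym δ-def)) (eq a k δ))) ⟩
    a + k + (δ + 0) ≤⟨ +-monoˡ-≤ (δ + 0) (minDegree u) ⟩
    degree u + (δ + 0) ∎
    where
    open ≤-Reasoning
    eq : ∀ a k δ → a + (2 * k + δ + 0) ≡ a + k + (δ + 0) + k
    eq = solve-∀

  k≤outdegree : ∀ u → k ≤ outdegree u
  k≤outdegree u =
    +-cancelʳ-≤ a _ _
    (≤-trans (≤-reflexive (+-comm k a))
    (≤-trans (minDegree u) (+-monoʳ-≤ (outdegree u) (indegree≤ balanced u))))

  k≤indegree : ∀ u → k ≤ indegree u
  k≤indegree u =
    +-cancelˡ-≤ a _ _ (≤-trans (minDegree u) (+-monoˡ-≤ (indegree u) (outdegree≤ balanced u)))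

  degreeSum : (Fin n → Bool) → ℕ
  degreeSum S = ∑[ u < n ] (ι (S u) * degree u)

  degreeSum-min : ∀ S {m} → Sized S m → 2 * m * (a + k) ≤ degreeSum S
  degreeSum-min S {m} s = begin
    2 * m * (a + k) ≡⟨ cong (_* (a + k)) (sized-∣∣ S s) ⟨
    ∣ S ∣ * (a + k) ≡⟨ *-distribʳ-sum (a + k) (ι ∘ S) ⟩
    ∑[ u < n ] (ι (S u) * (a + k)) ≤⟨ sum-mono (λ u → *-monoʳ-≤ (ι (S u)) (minDegree u)) ⟩
    degreeSum S ∎
    where open ≤-Reasoning

  degreeSum-high : ∀ S {m} → Sized S m → 2 * m * h ≤ degreeSum S + ∣ (λ u → S u ∧ low u) ∣ * δ
  degreeSum-high S {m} s = begin
    2 * m * h ≡⟨ cong (_* h) (sized-∣∣ S s) ⟨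
    ∣ S ∣ * h ≡⟨ *-distribʳ-sum h (ι ∘ S) ⟩
    ∑[ u < n ] (ι (S u) * h) ≤⟨ sum-mono le ⟩
    ∑[ u < n ] (ι (S u) * degree u + ι (S u ∧ low u) * δ)
      ≡⟨ ∑-distrib-+ (λ u → ι (S u) * degree u) (λ u → ι (S u ∧ low u) * δ) ⟩
    degreeSum S + ∑[ u < n ] (ι (S u ∧ low u) * δ)
      ≡⟨ cong (degreeSum S +_) (*-distribʳ-sum δ (λ u → ι (S u ∧ low u))) ⟨
    degreeSum S + ∣ (λ u → S u ∧ low u) ∣ * δ ∎
    where
    open ≤-Reasoning
    le : ∀ u → ι (S u) * h ≤ ι (S u) * degree u + ι (S u ∧ low u) * δ
    le u with S u
    ... | false = z≤n
    ... | true  = begin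
      h + 0 ≡⟨ +-identityʳ h ⟩
      h ≤⟨ high-bound u ⟩
      degree u + ι (low u) * δ ≡⟨ cong (_+ ι (low u) * δ) (+-identityʳ (degree u)) ⟨
      degree u + 0 + ι (low u) * δ ∎

  -- Since `N` exchanges the sides and preserves `S`, reindexing by `N` turns the count of one side
  -- of `S` into that of the other.
  sized-closed : ∀ {N : Fin n → Fin n} → Injective _≡_ _≡_ N → (∀ v → side (N v) ≡ not (side v)) →
    ∀ S → (∀ v → S (N v) ≡ S v) → ∃ λ m → Sized S m
  sized-closed {N} inj flips S SN = ∣ (λ v → S v ∧ side v) ∣ , λ { false → refl ; true → sym eq }
    where
    eq : ∣ (λ v → S v ∧ side v) ∣ ≡ ∣ (λ v → S v ∧ not (side v)) ∣
    eq = trans (sum-reindex inj (λ v → ι (S v ∧ side v)))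
      (sum-cong-≗ λ v → cong₂ (λ b c → ι (b ∧ c)) (SN v) (flips v))

  sized-partition : ∀ S T R {m t r} → (∀ v → ι (S v) + ι (T v) + ι (R v) ≡ 1) →
    Sized S m → Sized T t → Sized R r → m + t + r ≡ a
  sized-partition S T R {m} {t} {r} part s t′ r′ = begin
    m + t + r ≡⟨ cong₂ _+_ (cong₂ _+_ (s false) (t′ false)) (r′ false) ⟨
    sum (f S) + sum (f T) + sum (f R) ≡⟨ cong (_+ sum (f R)) (∑-distrib-+ (f S) (f T)) ⟨
    sum (λ v → f S v + f T v) + sum (f R) ≡⟨ ∑-distrib-+ (λ v → f S v + f T v) (f R) ⟨
    sum (λ v → f S v + f T v + f R v) ≡⟨ sum-cong-≗ pointwise ⟩
    sum (ι ∘ side) ≡⟨ balanced false ⟩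
    a ∎
    where
    open ≡-Reasoning
    f : (Fin n → Bool) → Fin n → ℕ
    f P v = ι (P v ∧ side v)
    pointwise : ∀ v → f S v + f T v + f R v ≡ ι (side v)
    pointwise v with side v
    ... | true rewrite Bool.∧-identityʳ (S v) | Bool.∧-identityʳ (T v) | Bool.∧-identityʳ (R v) = part v
    ... | false rewrite Bool.∧-zeroʳ (S v) | Bool.∧-zeroʳ (T v) | Bool.∧-zeroʳ (R v) = refl

  Unmergeable : (Fin n → Fin n) → (Fin n → Bool) → (Fin n → Bool) → Set
  Unmergeable N S T = ∀ u v → S u ≡ true → T v ≡ true → E u (N v) ≡ true → E v (N u) ≡ true → ⊥

  -- Arcs inside `S` are counted at both ends. The term `2 * m * t` for the crossing arcs is the
  -- number of same-side pairs, half of the `4 m t` possible arcs.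
  degreeSum-unmergeable : ∀ {N : Fin n → Fin n} → Injective _≡_ _≡_ N →
    (∀ v → side (N v) ≡ not (side v)) →
    ∀ S T R {m t} → (∀ v → S (N v) ≡ S v) → (∀ v → T (N v) ≡ T v) → Unmergeable N S T →
    (∀ v → ι (S v) + ι (T v) + ι (R v) ≡ 1) → Sized S m → Sized T t →
    degreeSum S ≤ 2 * m * t + 2 * cnt E S S + (cnt E S R + cnt E R S)
  degreeSum-unmergeable {N} inj flips S T R {m} {t} SN TN un part s t′ = begin
    degreeSum S ≡⟨ degree-split S T R part ⟩
    (cnt E S S + cnt E S T + cnt E S R) + (cnt E S S + cnt E T S + cnt E R S)
      ≡⟨ eq (cnt E S S) (cnt E S T) (cnt E S R) (cnt E T S) (cnt E R S) ⟩
    (cnt E S T + cnt E T S) + 2 * cnt E S S + (cnt E S R + cnt E R S)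
      ≤⟨ +-monoˡ-≤ (cnt E S R + cnt E R S)
        (+-monoˡ-≤ (2 * cnt E S S) (crossing-arcs inj flips S T SN TN un)) ⟩
    cnt same S T + 2 * cnt E S S + (cnt E S R + cnt E R S)
      ≡⟨ cong (λ x → x + 2 * cnt E S S + (cnt E S R + cnt E R S))
        (trans (cnt-same S T t′) (cong (_* t) (sized-∣∣ S s))) ⟩
    2 * m * t + 2 * cnt E S S + (cnt E S R + cnt E R S) ∎
    where
    open ≤-Reasoning
    eq : ∀ e b c d f → (e + b + c) + (e + d + f) ≡ (b + d) + 2 * e + (c + f)
    eq = solve-∀

  -- There are `4 * m * r` possible arcs between `S` and `R`, and the last premise says that at
  -- least `r` of them are absent: none for an empty remainder, one for a pair removed from a
  -- Hamiltonian cycle.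
  unmergeable-sizes : ∀ {N : Fin n → Fin n} → Injective _≡_ _≡_ N → (∀ v → side (N v) ≡ not (side v)) →
    ∀ S T R {m t r} → (∀ v → S (N v) ≡ S v) → (∀ v → T (N v) ≡ T v) → Unmergeable N S T →
    (∀ v → ι (S v) + ι (T v) + ι (R v) ≡ 1) → Sized S m → Sized T t → Sized R r →
    r ≤ 1 → 1 ≤ m → m ≤ t → cnt E S R + cnt E R S + r ≤ 4 * m * r → m ≡ k × t ≡ k
  unmergeable-sizes inj flips S T R {m} {t} {r} SN TN un part s t′ r′ r≤1 1≤m m≤t miss =
    extremal-sizes {e = cnt E S S} {l = ∣ (λ u → S u ∧ low u) ∣} 2≤k a<4k δ-def h-def r≤1 1≤m m≤t
      (sized-partition S T R part s t′ r′)
      (≤-trans (cnt-E≤opp S S) (≤-reflexive (trans (cnt-opp S S s) (cong (_* m) (sized-∣∣ S s)))))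
      (low-arcs low S s low-unique)
      (≤-trans (+-monoˡ-≤ r (degreeSum-min S s)) total)
      (begin
        2 * m * h + r ≤⟨ +-monoˡ-≤ r (degreeSum-high S s) ⟩
        degreeSum S + ∣ (λ u → S u ∧ low u) ∣ * δ + r
          ≡⟨ eq (degreeSum S) (∣ (λ u → S u ∧ low u) ∣ * δ) r ⟩
        degreeSum S + r + ∣ (λ u → S u ∧ low u) ∣ * δ ≤⟨ +-monoˡ-≤ (∣ (λ u → S u ∧ low u) ∣ * δ) total ⟩
        2 * m * t + 2 * cnt E S S + 4 * m * r + ∣ (λ u → S u ∧ low u) ∣ * δ ∎)
    where
    open ≤-Reasoning
    eq : ∀ x y z → x + y + z ≡ x + z + y
    eq = solve-∀
    total : degreeSum S + r ≤ 2 * m * t + 2 * cnt E S S + 4 * m * r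
    total = begin
      degreeSum S + r ≤⟨ +-monoˡ-≤ r (degreeSum-unmergeable inj flips S T R SN TN un part s t′) ⟩
      2 * m * t + 2 * cnt E S S + (cnt E S R + cnt E R S) + r
        ≡⟨ +-assoc (2 * m * t + 2 * cnt E S S) (cnt E S R + cnt E R S) r ⟩
      2 * m * t + 2 * cnt E S S + (cnt E S R + cnt E R S + r)
        ≤⟨ +-monoʳ-≤ (2 * m * t + 2 * cnt E S S) miss ⟩
      2 * m * t + 2 * cnt E S S + 4 * m * r ∎

  ∅ : Fin n → Bool
  ∅ _ = false

  ∁ : (Fin n → Bool) → Fin n → Bool
  ∁ S v = not (S v)

  sized-∅ : Sized ∅ 0
  sized-∅ b = sum-zero n

  sized-positive : ∀ S {m} → Sized S m → ∀ u → S u ≡ true → 1 ≤ m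
  sized-positive S {zero} s u u∈ = contradiction (subst (1 ≤_) (sized-∣∣ S s)
    (≤-trans (m≤n+m 1 _)
      (sum-mono-at {f = λ _ → 0} 1 (λ _ → z≤n) u (subst (λ b → 1 ≤ ι b) (sym u∈) ≤-refl)))) λ ()
  sized-positive S {suc m} s u u∈ = s≤s z≤n

  -- The deficit already shows on one side. If that part of `A` has only low vertices, their
  -- nonempty and disjoint out-neighbourhoods contradict it. Otherwise it has a vertex of degree at
  -- least `h`, with at least `h - a = a - k` out-neighbours, all in `B`. But some `y` on the side
  -- of those out-neighbours lies outside `B`, and its at least `k` in-neighbours avoid `A`, which
  -- leaves at most `a - k` vertices for that part of `A`.
  no-violator : ¬ Hall.Violator E
  no-violator (A , B , cl , lt) = case ∣ part′ true B ∣ <? ∣ part true A ∣ of λ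
    { (yes p) → one-sided true p
    ; (no p) → one-sided false (≰⇒> λ q → <⇒≱ lt (begin
        ∣ A ∣ ≡⟨ halves A ⟩
        ∣ part true A ∣ + ∣ part false A ∣ ≤⟨ +-mono-≤ (≮⇒≥ p) q ⟩
        ∣ part′ true B ∣ + ∣ part′ false B ∣ ≡⟨ +-comm ∣ part′ true B ∣ _ ⟩
        ∣ part′ false B ∣ + ∣ part′ true B ∣ ≡⟨ halves B ⟨
        ∣ B ∣ ∎)) }
    where
    open ≤-Reasoning
    part part′ : Bool → (Fin n → Bool) → Fin n → Bool
    part b S v = S v ∧ (b xor side v)
    part′ b S v = S v ∧ (not b xor side v)
    halves : ∀ S → ∣ S ∣ ≡ ∣ part true S ∣ + ∣ part false S ∣
    halves S = trans (sum-cong-≗ pointwise) (∑-distrib-+ (ι ∘ part true S) (ι ∘ part false S))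
      where
      pointwise : ∀ v → ι (S v) ≡ ι (part true S v) + ι (part false S v)
      pointwise v with S v | side v
      ... | true  | true  = refl
      ... | true  | false = refl
      ... | false | _     = refl
    one-sided : ∀ b → ¬ (∣ part′ b B ∣ < ∣ part b A ∣)
    one-sided b lt = case any? (λ u → (part b A u Bool.≟ true) ×-dec (low u Bool.≟ false)) of λ
      { (yes (u , u∈ , ¬lu)) → high u u∈ (¬low⇒≥ u ¬lu)
      ; (no none) →
        <⇒≱ lt (all-low λ u u∈ → decidable-stable (low u Bool.≟ true) λ ¬l →
        none (u , u∈ , not-true⇒false ¬l)) }
      where
      cl′ : ∀ u v → part b A u ≡ true → E u v ≡ true → part′ b B v ≡ true
      cl′ u v u∈ e with ∧-split (A u) (b xor side u) u∈
      ... | u∈A , bu rewrite cl u v u∈A e | bip u v e = trans (flip b (side u)) bu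
        where
        flip : ∀ b c → not b xor not c ≡ b xor c
        flip true  true  = refl
        flip true  false = refl
        flip false true  = refl
        flip false false = refl
      all-low : (∀ u → part b A u ≡ true → low u ≡ true) → ∣ part b A ∣ ≤ ∣ part′ b B ∣
      all-low lows = begin
        ∣ part b A ∣ ≤⟨ sum-mono one ⟩
        ∑[ u < n ] ∑[ v < n ] ι (part b A u ∧ E u v) ≡⟨ ∑-comm (λ u v → ι (part b A u ∧ E u v)) ⟩
        ∑[ v < n ] ∑[ u < n ] ι (part b A u ∧ E u v) ≤⟨ sum-mono atMost ⟩
        ∣ part′ b B ∣ ∎
        where
        one : ∀ u → ι (part b A u) ≤ ∑[ v < n ] ι (part b A u ∧ E u v)
        one u with part b A u
        ... | false = z≤n
        ... | true  = ≤-trans (≤-trans (s≤s z≤n) 2≤k) (k≤outdegree u)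
        atMost : ∀ v → ∑[ u < n ] ι (part b A u ∧ E u v) ≤ ι (part′ b B v)
        atMost v with part′ b B v in Bv
        ... | true = sum-unique (λ u → part b A u ∧ E u v) λ u u′ p q → case
          (∧-split (part b A u) (E u v) p , ∧-split (part b A u′) (E u′ v) q) of λ
          { ((x , y) , (z , w)) → low-unique u u′ v (lows u x) (lows u′ z) y w }
        ... | false = ≤-trans (sum-mono {g = λ _ → 0} none) (≤-reflexive (sum-zero n))
          where
          none : ∀ u → ι (part b A u ∧ E u v) ≤ 0
          none u with part b A u ∧ E u v in p
          ... | false = z≤n
          ... | true with x , y ← ∧-split (part b A u) (E u v) p = true≢false (cl′ u v x y) Bv
      missed : ∃ λ y → (not b xor side y ≡ true) × part′ b B y ≡ false
      missed with any? (λ y → ((not b xor side y) Bool.≟ true) ×-dec (part′ b B y Bool.≟ false))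
      ... | yes p = p
      ... | no none = contradiction lt (≤⇒≯ (begin
        ∣ part b A ∣ ≤⟨ sum-mono (λ v → drop v) ⟩
        ∑[ v < n ] ι (b xor side v) ≡⟨ trans (balanced b) (sym (balanced (not b))) ⟩
        ∑[ v < n ] ι (not b xor side v) ≤⟨ sum-mono le ⟩
        ∣ part′ b B ∣ ∎))
        where
        drop : ∀ v → ι (part b A v) ≤ ι (b xor side v)
        drop v with A v
        ... | true  = ≤-refl
        ... | false = z≤n
        le : ∀ v → ι (not b xor side v) ≤ ι (part′ b B v)
        le v with not b xor side v in p
        ... | false = z≤n
        ... | true = ≤-reflexive
          (sym (cong ι (decidable-stable ((B v ∧ true) Bool.≟ true) λ q →
          none (v , p , trans (cong (B v ∧_) p) (not-true⇒false q)))))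
      A-small : ∣ part b A ∣ + k ≤ a
      A-small with y , sy , y∉ ← missed = begin
        ∣ part b A ∣ + k ≤⟨ +-monoʳ-≤ ∣ part b A ∣ (k≤indegree y) ⟩
        ∣ part b A ∣ + indegree y ≡⟨ ∑-distrib-+ (ι ∘ part b A) (λ u → ι (E u y)) ⟨
        ∑[ u < n ] (ι (part b A u) + ι (E u y)) ≤⟨ sum-mono le ⟩
        ∑[ u < n ] ι (b xor side u) ≡⟨ balanced b ⟩
        a ∎
        where
        toSide : ∀ u → E u y ≡ true → b xor side u ≡ true
        toSide u e = flip b (side u) (side y) (bip u y e) sy
          where
          flip : ∀ b c d → d ≡ not c → not b xor d ≡ true → b xor c ≡ true
          flip true  false _ refl _ = refl
          flip false true  _ refl _ = refl
        le : ∀ u → ι (part b A u) + ι (E u y) ≤ ι (b xor side u)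
        le u with E u y in e | A u in Au
        ... | true  | true rewrite toSide u e =
          true≢false (cl′ u y (trans (cong₂ _∧_ Au (toSide u e)) refl) e) y∉
        ... | true  | false rewrite toSide u e = ≤-refl
        ... | false | true = ≤-reflexive (+-identityʳ _)
        ... | false | false = z≤n
      high : ∀ u → part b A u ≡ true → ¬ (h ≤ degree u)
      high u u∈ hu = <-irrefl refl (begin-strict
        a ≤⟨ +-cancelʳ-≤ a _ _ (begin
          a + a ≡⟨ cong (a +_) (+-identityʳ a) ⟨
          2 * a ≡⟨ h-def ⟨
          h + k ≤⟨ +-monoˡ-≤ k (≤-trans hu (+-monoʳ-≤ (outdegree u) (indegree≤ balanced u))) ⟩
          outdegree u + a + k
            ≡⟨ trans (+-assoc (outdegree u) a k)
            (trans (cong (outdegree u +_) (+-comm a k)) (sym (+-assoc (outdegree u) k a))) ⟩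
          outdegree u + k + a ∎) ⟩
        outdegree u + k ≤⟨ +-monoˡ-≤ k (sum-mono le) ⟩
        ∣ part′ b B ∣ + k <⟨ +-monoˡ-< k lt ⟩
        ∣ part b A ∣ + k ≤⟨ A-small ⟩
        a ∎)
        where
        le : ∀ v → ι (E u v) ≤ ι (part′ b B v)
        le v with E u v in e
        ... | false = z≤n
        ... | true rewrite cl′ u v u∈ e = ≤-refl

  factor : Hall.Matching E
  factor with Hall.hall E
  ... | inj₁ M = M
  ... | inj₂ V = contradiction V no-violator

-- Hamiltonian cycles

module HamiltonCycle {n} {E : Fin n → Fin n → Bool} {side : Fin n → Bool}
  {bip : ∀ u v → E u v ≡ true → side v ≡ not (side u)} {a k δ h : ℕ}
  (conditions : Conditions E side bip a k δ h) where

  open Main conditions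

  -- A cycle factor with one distinguished cycle `S`, the one to be enlarged; the complement of `S`
  -- may fall into several cycles.
  record Factor : Set where
    field
      N     : Fin n → Fin n
      inj   : Injective _≡_ _≡_ N
      arcs  : ∀ v → E v (N v) ≡ true
      S     : Fin n → Bool
      orbit : Orbit N S

    flips : ∀ v → side (N v) ≡ not (side v)
    flips v = bip v (N v) (arcs v)

    S-closed : ∀ v → S (N v) ≡ S v
    S-closed = closed-back inj S (Orbit.closed orbit)

  open Factor

  Larger : Factor → Set
  Larger F = Σ Factor λ G → ∣ S F ∣ < ∣ S G ∣

  merge-step : ∀ F u v → S F u ≡ true → S F v ≡ false → E u (N F v) ≡ true → E v (N F u) ≡ true →
    Larger F
  merge-step F u v u∈ v∉ uv vu = G , (begin-strict
      ∣ S F ∣ <⟨ m<m+n ∣ S F ∣ positive ⟩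
      ∣ S F ∣ + ∣ B ∣ ≡⟨ ∣∣-disjoint (S F) B disjoint ⟨
      ∣ (λ w → S F w ∨ B w) ∣ ∎)
    where
    open ≤-Reasoning
    B : Fin n → Bool
    B = orbitOf (inj F) v
    OB : Orbit (N F) B
    OB = reroot (inj F) (orbitOf-orbit (inj F) v) v (orbitOf-self (inj F) v)
    positive : 1 ≤ ∣ B ∣
    positive = ≤-trans (m≤n+m 1 _)
      (sum-mono-at {f = λ _ → 0} 1 (λ _ → z≤n) v
      (subst (λ b → 1 ≤ ι b) (sym (orbitOf-self (inj F) v)) ≤-refl))
    disjoint : ∀ w → S F w ≡ true → B w ≡ true → ⊥
    disjoint w w∈ w∈B with i , e ← Orbit.reach OB w w∈B =
      true≢false (trans (cong (S F) (sym e)) (Orbit.closed-iterate (orbit F) i w w∈)) v∉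
    module M = Merge (inj F) (orbit F) OB disjoint u v u∈ (orbitOf-self (inj F) v)
    G : Factor
    G .N = M.merged
    G .inj = M.merged-injective
    G .S w = S F w ∨ B w
    G .orbit = M.merged-orbit
    G .arcs w = case w ≟ u of λ
      { (yes refl) → trans (cong (λ x → E w (N F x)) (swap-left u v)) uv
      ; (no w≢u) → case w ≟ v of λ
        { (yes refl) → trans (cong (λ x → E w (N F x)) (swap-right u v)) vu
        ; (no w≢v) → trans (cong (λ x → E w (N F x)) (swap-other u v w≢u w≢v)) (arcs F w) } }

  cnt-∅ : ∀ S → cnt E S ∅ + cnt E ∅ S ≡ 0
  cnt-∅ S = cong₂ _+_
    (n≤0⇒n≡0 (≤-trans (cnt-E≤opp S ∅) (≤-reflexive (trans (cnt-opp S ∅ sized-∅) (*-zeroʳ ∣ S ∣)))))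
    (trans (sum-cong-≗ {n} {λ _ → sum {n} (λ _ → 0)} {λ _ → 0} λ u → sum-zero n) (sum-zero n))

  complement-partition : ∀ S v → ι (S v) + ι (∁ S v) + ι (∅ v) ≡ 1
  complement-partition S v with S v
  ... | true  = refl
  ... | false = refl

  complement-partition′ : ∀ S v → ι (∁ S v) + ι (S v) + ι (∅ v) ≡ 1
  complement-partition′ S v with S v
  ... | true  = refl
  ... | false = refl

  -- Here `a = 2k`, so the degree sum of `S` is at least `6 k²`, while crossing arcs contribute at
  -- most `2 k²` and arcs inside `S` at most `4 k²`. Equality leaves no room for a missing arc.
  halves-complete : ∀ {N : Fin n → Fin n} → Injective _≡_ _≡_ N → (∀ v → side (N v) ≡ not (side v)) →
    ∀ S T → (∀ v → S (N v) ≡ S v) → (∀ v → T (N v) ≡ T v) → Unmergeable N S T →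
    (∀ v → ι (S v) + ι (T v) + ι (∅ v) ≡ 1) → Sized S k → Sized T k →
    ∀ u v → S u ≡ true → S v ≡ true → opp u v ≡ true → E u v ≡ true
  halves-complete inj flips S T SN TN un part s t u v u∈ v∈ o =
    decidable-stable (E u v Bool.≟ true) λ ¬e → 1+n≰n (+-cancelʳ-≤ 1 _ _ (begin
      suc (2 * k * (a + k)) + 1 ≡⟨ eq₀ (2 * k * (a + k)) ⟩
      2 * k * (a + k) + 2
        ≤⟨ +-monoˡ-≤ 2
        (≤-trans (degreeSum-min S s) (degreeSum-unmergeable inj flips S T ∅ SN TN un part s t)) ⟩
      2 * k * k + 2 * cnt E S S + (cnt E S ∅ + cnt E ∅ S) + 2
        ≡⟨ cong (λ x → 2 * k * k + 2 * cnt E S S + x + 2) (cnt-∅ S) ⟩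
      2 * k * k + 2 * cnt E S S + 0 + 2 ≡⟨ eq₁ k (cnt E S S) ⟩
      2 * k * k + 2 * (cnt E S S + 1)
        ≤⟨ +-monoʳ-≤ (2 * k * k) (*-monoʳ-≤ 2 (cnt-missing S S u v u∈ v∈ o (not-true⇒false ¬e))) ⟩
      2 * k * k + 2 * cnt opp S S
        ≡⟨ cong (λ x → 2 * k * k + 2 * x) (trans (cnt-opp S S s) (cong (_* k) (sized-∣∣ S s))) ⟩
      2 * k * k + 2 * (2 * k * k) ≡⟨ eq₂ k ⟩
      2 * k * (k + k + 0 + k) ≡⟨ cong (λ x → 2 * k * (x + k)) (sized-partition S T ∅ part s t sized-∅) ⟩
      2 * k * (a + k) ≤⟨ m≤m+n _ 1 ⟩
      2 * k * (a + k) + 1 ∎))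
    where
    open ≤-Reasoning
    eq₀ : ∀ x → suc x + 1 ≡ x + 2
    eq₀ = solve-∀
    eq₁ : ∀ k e → 2 * k * k + 2 * e + 0 + 2 ≡ 2 * k * k + 2 * (e + 1)
    eq₁ = solve-∀
    eq₂ : ∀ k → 2 * k * k + 2 * (2 * k * k) ≡ 2 * k * (k + k + 0 + k)
    eq₂ = solve-∀

  -- Conjugation by the transposition of `s` and `N F u` makes `s` the successor of `u`. The
  -- transposed vertices share their half and their side, so `S` stays one cycle, the required arcs
  -- exist by completeness, and the other half keeps its successors.
  reassign : ∀ F → (∀ u v → S F u ≡ S F v → side v ≡ not (side u) → E u v ≡ true) →
    ∀ u s → S F s ≡ S F u → side s ≡ not (side u) →
    Σ Factor λ G → S G ≡ S F × N G u ≡ s × (∀ w → ¬ (S F w ≡ S F u) → N G w ≡ N F w)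
  reassign F complete u s Ss sides = G , refl , G-u , G-other
    where
    σ : Fin n → Fin n
    σ = swap s (N F u)
    σ-S : ∀ w → S F (σ w) ≡ S F w
    σ-S = swap-preserves (S F) s (N F u) (trans Ss (sym (S-closed F u)))
    σ-side : ∀ w → side (σ w) ≡ side w
    σ-side = swap-preserves side s (N F u) (trans sides (sym (flips F u)))
    G : Factor
    G .N = σ ∘ N F ∘ σ
    G .inj = swap-injective s (N F u) ∘ inj F ∘ swap-injective s (N F u)
    G .S = S F
    G .orbit = conjugate-orbit (inj F) σ (swap-involutive s (N F u)) σ-S (orbit F)
    G .arcs w = complete w _ (sym (trans (σ-S _) (trans (S-closed F _) (σ-S w))))
      (trans (σ-side _) (trans (flips F _) (cong not (σ-side w))))
    G-u : σ (N F (σ u)) ≡ s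
    G-u = trans (cong (σ ∘ N F)
      (swap-other s (N F u) (λ e → b≢not-b (trans (cong side e) sides))
      (λ e → b≢not-b (trans (cong side e) (flips F u))))) (swap-right s (N F u))
    G-other : ∀ w → ¬ (S F w ≡ S F u) → σ (N F (σ w)) ≡ N F w
    G-other w w≢ =
      trans (cong (σ ∘ N F) (fixed w w≢)) (fixed (N F w) (λ e → w≢ (trans (sym (S-closed F w)) e)))
      where
      fixed : ∀ x → ¬ (S F x ≡ S F u) → σ x ≡ x
      fixed x x≢ = swap-other s (N F u) (λ { refl → x≢ Ss }) (λ { refl → x≢ (S-closed F u) })

  module Extremal (F : Factor) (complete : ∀ u v → S F u ≡ S F v → side v ≡ not (side u) → E u v ≡ true)
    (s : Sized (S F) k) (a≡ : k + k ≡ a) where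

    -- Both halves are complete, so any Hamiltonian cycle of a half may be chosen.
    rewire : ∀ u v x y → S F u ≡ true → S F v ≡ false → S F x ≡ true → S F y ≡ false →
      side u ≡ side v → E u y ≡ true → E v x ≡ true → Larger F
    rewire u v x y u∈ v∉ x∈ y∉ sides uy vx
      with G₁ , refl , G₁u , _ ← reassign F complete u x (trans x∈ (sym u∈))
        (trans (bip v x vx) (cong not (sym sides)))
      with G₂ , refl , G₂v , G₂o ← reassign G₁ complete v y (trans y∉ (sym v∉))
        (trans (bip u y uy) (cong not sides))
      = merge-step G₂ u v u∈ v∉
        (trans (cong (E u) G₂v) uy)
        (trans (cong (E v) (trans (G₂o u λ e → true≢false u∈ (trans e v∉)) G₁u)) vx)

    module _ (none : ∀ u v x y → S F u ≡ true → S F v ≡ false → S F x ≡ true → S F y ≡ false →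
      side u ≡ side v → E u y ≡ true → E v x ≡ true → ⊥) where

      -- Within its half `y` has degree at most `2k = a`, which is less than `a + k`.
      leaves : ∀ y → S F y ≡ true → ∃ λ w → S F w ≡ false × (E y w ≡ true ⊎ E w y ≡ true)
      leaves y y∈ with any?
        (λ w → (S F w Bool.≟ false) ×-dec ((E y w Bool.≟ true) ⊎-dec (E w y Bool.≟ true)))
      ... | yes p = p
      ... | no ¬p = contradiction (begin
          a + k ≤⟨ minDegree y ⟩
          outdegree y + indegree y ≤⟨ +-mono-≤ (sum-mono out) (sum-mono inn) ⟩
          ∣ (λ w → S F w ∧ opp y w) ∣ + ∣ (λ w → S F w ∧ opp y w) ∣
            ≡⟨ cong₂ _+_ (s (side y)) (s (side y)) ⟩
          k + k ≡⟨ a≡ ⟩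
          a ∎) (<⇒≱ (m<m+n a (≤-trans (s≤s z≤n) 2≤k)))
        where
        open ≤-Reasoning
        out : ∀ w → ι (E y w) ≤ ι (S F w ∧ opp y w)
        out w with S F w in w∈
        ... | true = ιE≤ιopp y w
        ... | false = ≤-reflexive (cong ι (not-true⇒false λ e → ¬p (w , w∈ , inj₁ e)))
        inn : ∀ w → ι (E w y) ≤ ι (S F w ∧ opp y w)
        inn w with S F w in w∈
        ... | true = ≤-trans (ιE≤ιopp w y) (≤-reflexive (cong ι (opp-sym w y)))
        ... | false = ≤-reflexive (cong ι (not-true⇒false λ e → ¬p (w , w∈ , inj₂ e)))

      -- Strong connectivity supplies an arc `u₀ → t₀` leaving `S` and an arc `v₁ → s₁` entering it.
      -- If `u₀` and `v₁` are on different sides, the successor of `u₀` is on the side of `v₁`, and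
      -- an arc between that successor and the outside pairs, in either direction, with one of the
      -- two given arcs.
      impossible : ∀ v → S F v ≡ false → ⊥
      impossible v v∉
        with u₀ , t₀ , u₀∈ , t₀∉ , u₀t₀ ← strong (S F) (Orbit.root (orbit F)) v
          (Orbit.root∈ (orbit F)) v∉
        with v₁ , s₁ , v₁∉ , s₁∈ , v₁s₁ ← strong (∁ (S F)) v (Orbit.root (orbit F)) (cong not v∉)
          (cong not (Orbit.root∈ (orbit F)))
        with side u₀ Bool.≟ side v₁
      ... | yes e =
        none u₀ v₁ s₁ t₀ u₀∈ (Bool.not-injective v₁∉) (Bool.not-injective s₁∈) t₀∉ e u₀t₀ v₁s₁
      ... | no ¬e with y∈ ← trans (S-closed F u₀) u₀∈ with leaves (N F u₀) y∈
      ...   | w , w∉ , inj₁ yw =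
        none (N F u₀) v₁ s₁ w y∈ (Bool.not-injective v₁∉) (Bool.not-injective s₁∈) w∉
                (trans (flips F u₀) (sym (Bool.¬-not (¬e ∘ sym)))) yw v₁s₁
      ...   | w , w∉ , inj₂ wy = none u₀ w (N F u₀) t₀ u₀∈ w∉ y∈ t₀∉
                (Bool.not-injective (trans (sym (flips F u₀)) (bip w (N F u₀) wy))) u₀t₀ wy

    larger : ∀ v → S F v ≡ false → Larger F
    larger v v∉ with any? (λ u → any? λ v → any? λ x → any? λ y →
        (S F u Bool.≟ true) ×-dec (S F v Bool.≟ false) ×-dec (S F x Bool.≟ true) ×-dec
          (S F y Bool.≟ false)
        ×-dec (side u Bool.≟ side v) ×-dec (E u y Bool.≟ true) ×-dec (E v x Bool.≟ true))
    ... | yes (u , v , x , y , p₁ , p₂ , p₃ , p₄ , p₅ , p₆ , p₇) = rewire u v x y p₁ p₂ p₃ p₄ p₅ p₆ p₇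
    ... | no none = ⊥-elim (impossible (λ u v x y p₁ p₂ p₃ p₄ p₅ p₆ p₇ →
      none (u , v , x , y , p₁ , p₂ , p₃ , p₄ , p₅ , p₆ , p₇)) v v∉)

  module Stuck (F : Factor) (unmergeable : Unmergeable (N F) (S F) (∁ (S F))) (v : Fin n)
    (v∉ : S F v ≡ false) where

    A T : Fin n → Bool
    A = S F
    T = ∁ A

    T-closed : ∀ w → T (N F w) ≡ T w
    T-closed w = cong not (S-closed F w)

    unmergeable′ : Unmergeable (N F) T A
    unmergeable′ u w u∈ w∈ uw wu = unmergeable w u w∈ u∈ wu uw

    no-rest : ∀ B m → cnt E B ∅ + cnt E ∅ B + 0 ≤ 4 * m * 0
    no-rest B m = ≤-reflexive (trans (+-identityʳ _) (trans (cnt-∅ B) (sym (*-zeroʳ (4 * m)))))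

    -- The count has to be applied to the smaller part; its conclusion is symmetric, so exchanging
    -- the parts covers both cases.
    halves : ∀ {m t} → Sized A m → Sized T t → m ≤ t ⊎ t ≤ m → m ≡ k × t ≡ k
    halves {m} s s′ (inj₁ m≤t) =
      unmergeable-sizes (inj F) (flips F) A T ∅ (S-closed F) T-closed unmergeable
      (complement-partition A) s s′ sized-∅ z≤n (sized-positive A s _ (Orbit.root∈ (orbit F))) m≤t
        (no-rest A m)
    halves {m} {t} s s′ (inj₂ t≤m) =
      ×-swap (unmergeable-sizes (inj F) (flips F) T A ∅ T-closed (S-closed F) unmergeable′
      (complement-partition′ A) s′ s sized-∅ z≤n (sized-positive T s′ v (cong not v∉)) t≤m (no-rest T t))

    sized-A : Sized A k
    sized-A = subst (Sized A) (proj₁ (halves (proj₂ sA) (proj₂ sT) (≤-total _ _))) (proj₂ sA)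
      where
      sA = sized-closed (inj F) (flips F) A (S-closed F)
      sT = sized-closed (inj F) (flips F) T T-closed

    sized-T : Sized T k
    sized-T = subst (Sized T) (proj₂ (halves (proj₂ sA) (proj₂ sT) (≤-total _ _))) (proj₂ sT)
      where
      sA = sized-closed (inj F) (flips F) A (S-closed F)
      sT = sized-closed (inj F) (flips F) T T-closed

    a≡ : k + k ≡ a
    a≡ = trans (sym (+-identityʳ _))
      (sized-partition A T ∅ (complement-partition A) sized-A sized-T sized-∅)

    complete : ∀ u w → A u ≡ A w → side w ≡ not (side u) → E u w ≡ true
    complete u w e o = go (A u) refl
      where
      go : ∀ b → A u ≡ b → E u w ≡ true
      go true Au = halves-complete (inj F) (flips F) A T (S-closed F) T-closed unmergeable
        (complement-partition A) sized-A sized-T u w Au (trans (sym e) Au) (flip⇒opp u w o)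
      go false Au = halves-complete (inj F) (flips F) T A T-closed (S-closed F) unmergeable′
        (complement-partition′ A) sized-T sized-A u w (cong not Au) (cong not (trans (sym e) Au))
          (flip⇒opp u w o)

    stuck-larger : Larger F
    stuck-larger = Extremal.larger F complete sized-A a≡ v v∉

  mergeable? : ∀ F →
    Dec (∃ λ u → ∃ λ w → S F u ≡ true × S F w ≡ false × E u (N F w) ≡ true × E w (N F u) ≡ true)
  mergeable? F = any? λ u → any? λ w → (S F u Bool.≟ true) ×-dec (S F w Bool.≟ false)
    ×-dec (E u (N F w) Bool.≟ true) ×-dec (E w (N F u) Bool.≟ true)

  larger : ∀ F v → S F v ≡ false → Larger F
  larger F v v∉ = case mergeable? F of λ
    { (yes (u , w , u∈ , w∉ , uw , wu)) → merge-step F u w u∈ w∉ uw wu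
    ; (no none) → Stuck.stuck-larger F
        (λ u w u∈ w∈ uw wu → none (u , w , u∈ , Bool.not-injective w∈ , uw , wu)) v v∉ }

  -- The fuel bounds the number of vertices off the distinguished cycle, and every enlargement
  -- lowers that number.
  hamiltonian-fuel : ∀ f (F : Factor) → n ≤ ∣ S F ∣ + f → Σ Factor λ G → ∀ v → S G v ≡ true
  hamiltonian-fuel f F le with any? (λ v → S F v Bool.≟ false)
  ... | no all = F , λ v → Bool.¬-not λ e → all (v , e)
  ... | yes (v , v∉) with larger F v v∉
  hamiltonian-fuel zero F le | yes (v , v∉) | G , lt =
    contradiction (≤-trans (≤-trans le (≤-reflexive (+-identityʳ _))) ≤-refl)
      (<⇒≱ (<-≤-trans lt (∣∣≤ (S G))))
  hamiltonian-fuel (suc f) F le | yes (v , v∉) | G , lt =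
    hamiltonian-fuel f G (≤-trans le (≤-trans (≤-reflexive (+-suc _ f)) (+-monoˡ-≤ f lt)))

  hamiltonian : Fin n → Σ Factor λ G → ∀ v → S G v ≡ true
  hamiltonian v with f , inj , arcs ← factor = hamiltonian-fuel n
    (record { N = f ; inj = inj ; arcs = arcs ; S = orbitOf inj v ; orbit = orbitOf-orbit inj v })
      (m≤n+m n _)

-- Cycles of length 2a − 2

-- The cycle of `N` through `b` contains every vertex; `pos` cuts it open in front of `b`, so that
-- its segments become intervals of positions.
record Position {n} (N : Fin n → Fin n) (b : Fin n) (L : ℕ) : Set where
  field
    pos    : Fin n → ℕ
    pos<   : ∀ w → pos w < L
    at     : ∀ w → iterate N b (pos w) ≡ w
    pos-at : ∀ i → i < L → pos (iterate N b i) ≡ i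
    return : iterate N b L ≡ b

  pos-next : ∀ w → suc (pos w) < L → pos (N w) ≡ suc (pos w)
  pos-next w lt =
    trans (cong pos (trans (cong N (sym (at w))) (sym (iterate-suc N b (pos w))))) (pos-at _ lt)

  pos-injective : ∀ v w → pos v ≡ pos w → v ≡ w
  pos-injective v w e = trans (sym (at v)) (trans (cong (iterate N b) e) (at w))

  count-below : ∀ c → c ≤ L → ∑[ w < n ] ι (does (pos w <? c)) ≡ c
  count-below zero    _  = sum-zero n
  count-below (suc c) c< = begin
    ∑[ w < n ] ι (does (pos w <? suc c)) ≡⟨ sum-cong-≗ split ⟩
    ∑[ w < n ] (ι (does (pos w <? c)) + ι (iterate N b c == w))
      ≡⟨ ∑-distrib-+ (λ w → ι (does (pos w <? c))) (λ w → ι (iterate N b c == w)) ⟩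
    ∑[ w < n ] ι (does (pos w <? c)) + ∑[ w < n ] ι (iterate N b c == w)
      ≡⟨ cong₂ _+_ (count-below c (<⇒≤ c<)) (sum-==ʳ (iterate N b c)) ⟩
    c + 1 ≡⟨ +-comm c 1 ⟩
    suc c ∎
    where
    open ≡-Reasoning
    split : ∀ w → ι (does (pos w <? suc c)) ≡ ι (does (pos w <? c)) + ι (iterate N b c == w)
    split w with <-cmp (pos w) c
    ... | tri< lt ne _ rewrite dec-true (pos w <? suc c) (m<n⇒m<1+n lt) | dec-true (pos w <? c) lt
      | dec-false (iterate N b c ≟ w) (λ { refl → ne (pos-at c c<) }) = refl
    ... | tri≈ nlt e _ rewrite dec-true (pos w <? suc c) (s≤s (≤-reflexive e)) | dec-false
      (pos w <? c) nlt
      | dec-true (iterate N b c ≟ w) (trans (cong (iterate N b) (sym e)) (at w)) = refl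
    ... | tri> nlt ne gt rewrite dec-false (pos w <? suc c)
      (λ lt → <-irrefl refl (<-≤-trans gt (s≤s⁻¹ lt))) | dec-false (pos w <? c) nlt
      | dec-false (iterate N b c ≟ w) (λ { refl → ne (pos-at c c<) }) = refl

abstract
  position : ∀ {n} {N : Fin n → Fin n} → Injective _≡_ _≡_ N → Orbit N (λ _ → true) → ∀ b {L} →
    ∣ (λ (_ : Fin n) → true) ∣ ≡ L → Position N b L
  position inj O b refl = record
    { pos    = λ w → proj₁ (T.index w refl)
    ; pos<   = λ w → proj₁ (proj₂ (T.index w refl))
    ; at     = λ w → proj₂ (proj₂ (T.index w refl))
    ; pos-at = λ i i< → T.distinct _ _ (proj₁ (proj₂ (T.index _ refl))) i<
      (proj₂ (proj₂ (T.index _ refl)))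
    ; return = T.returns }
    where module T = Traversal inj O b refl

module PreHamiltonCycle {n} {E : Fin n → Fin n → Bool} {side : Fin n → Bool}
  {bip : ∀ u v → E u v ≡ true → side v ≡ not (side u)} {a k δ h : ℕ}
  (conditions : Conditions E side bip a k δ h) where

  open Main conditions

  -- Off the cycle `S`, the permutation `M` need not follow arcs. It still changes sides there,
  -- which lets sums over all vertices be reindexed along `M`.
  record PreHamiltonian : Set where
    field
      M     : Fin n → Fin n
      inj   : Injective _≡_ _≡_ M
      flips : ∀ v → side (M v) ≡ not (side v)
      S     : Fin n → Bool
      orbit : Orbit M S
      arcs  : ∀ v → S v ≡ true → E v (M v) ≡ true
      size  : ∣ S ∣ + 2 ≡ 2 * a

  size-all : ∣ (λ (_ : Fin n) → true) ∣ ≡ 2 * a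
  size-all = sized-∣∣ (λ _ → true) balanced

  4≤a : 4 ≤ a
  4≤a = ≤-trans (*-monoʳ-≤ 2 2≤k) (≤-trans (m≤m+n (2 * k) δ) (≤-reflexive δ-def))

  8≤2a : 8 ≤ 2 * a
  8≤2a = *-monoʳ-≤ 2 4≤a

  module _ {N : Fin n → Fin n} (inj : Injective _≡_ _≡_ N) (arcs : ∀ v → E v (N v) ≡ true)
    (O : Orbit N (λ _ → true)) where

    flips : ∀ v → side (N v) ≡ not (side v)
    flips v = bip v (N v) (arcs v)

    P : ∀ u → Position N (N u) (2 * a)
    P u = position inj O (N u) size-all

    pos-last : ∀ u → Position.pos (P u) u ≡ 2 * a ∸ 1
    pos-last u = trans (cong pos u≡) (pos-at (2 * a ∸ 1) last<)
      where
      open Position (P u)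
      2a≡ : 2 * a ≡ suc (2 * a ∸ 1)
      2a≡ = sym (m+[n∸m]≡n (≤-trans (s≤s z≤n) 8≤2a))
      last< : 2 * a ∸ 1 < 2 * a
      last< = ≤-reflexive (sym 2a≡)
      u≡ : u ≡ iterate N (N u) (2 * a ∸ 1)
      u≡ = inj (trans (sym return)
        (trans (cong (iterate N (N u)) 2a≡) (iterate-suc N (N u) (2 * a ∸ 1))))

    -- The constant 8 comes from `a ≥ 2k ≥ 4`, which guarantees that many different positions.
    distinct-near : ∀ u i j → i < 8 → j < 8 → ¬ (i ≡ j) → ¬ (iterate N (N u) i ≡ iterate N (N u) j)
    distinct-near u i j i< j< i≢j e =
      i≢j (trans (sym (pos-at i (<-≤-trans i< 8≤2a)))
      (trans (cong pos e) (pos-at j (<-≤-trans j< 8≤2a))))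
      where open Position (P u)

    -- The chord bypasses `N u` and `N² u`. To remain a permutation, `M` sends `z₂` back to `z₁`,
    -- whether or not this is an arc.
    chord : ∀ u → E u (N (N (N u))) ≡ true → PreHamiltonian
    chord u e = record
      { M = M ; inj = swap-injective u z₂ ∘ inj ; flips =
        λ v → trans (flips _) (cong not (swap-preserves side u z₂ side-z₂ v))
      ; S = S ; orbit = OS ; arcs = arcsS ; size = trans sizes size-all }
      where
      z₁ z₂ : Fin n
      z₁ = N u
      z₂ = N z₁
      side-z₂ : side u ≡ side z₂
      side-z₂ = sym (trans (flips z₁) (trans (cong not (flips u)) (Bool.not-involutive (side u))))
      M : Fin n → Fin n
      M = N ∘ swap u z₂
      S : Fin n → Bool
      S w = not (z₁ == w) ∧ not (z₂ == w)
      z₁≢z₂ : ¬ (z₁ ≡ z₂)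
      z₁≢z₂ = distinct-near u 0 1 (s≤s z≤n) (s≤s (s≤s z≤n)) λ ()
      ∈S : ∀ w → ¬ (z₁ ≡ w) → ¬ (z₂ ≡ w) → S w ≡ true
      ∈S w p q rewrite dec-false (z₁ ≟ w) p | dec-false (z₂ ≟ w) q = refl
      ≢z₁ : ∀ {w} → S w ≡ true → ¬ (z₁ ≡ w)
      ≢z₁ {w} w∈ = ¬does⇒ (z₁ ≟ w) (Bool.not-injective (proj₁ (∧-split (not (z₁ == w)) _ w∈)))
      ≢z₂ : ∀ {w} → S w ≡ true → ¬ (z₂ ≡ w)
      ≢z₂ {w} w∈ = ¬does⇒ (z₂ ≟ w) (Bool.not-injective (proj₂ (∧-split (not (z₁ == w)) _ w∈)))
      M≡N : ∀ {w} → S w ≡ true → ¬ (w ≡ u) → M w ≡ N w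
      M≡N w∈ w≢u = cong N (swap-other u z₂ w≢u (≢z₂ w∈ ∘ sym))
      M-u : M u ≡ N z₂
      M-u = cong N (swap-left u z₂)
      next∈ : ∀ w → S w ≡ true → ¬ (w ≡ u) → S (N w) ≡ true
      next∈ w w∈ w≢u = ∈S (N w) (λ q → w≢u (sym (inj q))) (λ q → ≢z₁ w∈ (inj q))
      u∈ : S u ≡ true
      u∈ = ∈S u (λ q → b≢not-b (trans (cong side (sym q)) (flips u)))
        (λ q → distinct-near u 2 0 (s≤s (s≤s (s≤s z≤n))) (s≤s z≤n) (λ ()) (cong N q))
      skip : ∀ d w → S w ≡ true → iterate N w d ≡ u → ∃ λ j → iterate M w j ≡ u
      skip zero w w∈ q = 0 , q
      skip (suc d) w w∈ q with w ≟ u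
      ... | yes w≡u = 0 , w≡u
      ... | no w≢u with j , q′ ← skip d (N w) (next∈ w w∈ w≢u) q =
        suc j , trans (cong (λ x → iterate M x j) (M≡N w∈ w≢u)) q′
      OS : Orbit M S
      OS .Orbit.root = u
      OS .Orbit.root∈ = u∈
      OS .Orbit.closed w w∈ = case w ≟ u of λ
        { (yes refl) →
          trans (cong S M-u) (∈S (N z₂) (distinct-near u 0 2 (s≤s z≤n) (s≤s (s≤s (s≤s z≤n))) (λ ()))
                         (distinct-near u 1 2 (s≤s (s≤s z≤n)) (s≤s (s≤s (s≤s z≤n))) (λ ())))
        ; (no w≢u) → trans (cong S (M≡N w∈ w≢u)) (next∈ w w∈ w≢u) }
      OS .Orbit.reach w w∈ with d , q ← Orbit.reach (reroot inj O u refl) w refl = skip d w w∈ q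
      arcsS : ∀ v → S v ≡ true → E v (M v) ≡ true
      arcsS w w∈ = case w ≟ u of λ
        { (yes refl) → trans (cong (E u) M-u) e
        ; (no w≢u) → trans (cong (E w) (M≡N w∈ w≢u)) (arcs w) }
      sizes : ∣ S ∣ + 2 ≡ ∣ (λ (_ : Fin n) → true) ∣
      sizes = begin
        ∣ S ∣ + (1 + 1) ≡⟨ cong (∣ S ∣ +_) (cong₂ _+_ (sum-==ʳ z₁) (sum-==ʳ z₂)) ⟨
        ∣ S ∣ + (∣ (z₁ ==_) ∣ + ∣ (z₂ ==_) ∣)
          ≡⟨ cong (∣ S ∣ +_) (∑-distrib-+ (ι ∘ (z₁ ==_)) (ι ∘ (z₂ ==_))) ⟨
        ∣ S ∣ + ∑[ w < n ] (ι (z₁ == w) + ι (z₂ == w))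
          ≡⟨ ∑-distrib-+ (ι ∘ S) (λ w → ι (z₁ == w) + ι (z₂ == w)) ⟨
        ∑[ w < n ] (ι (S w) + (ι (z₁ == w) + ι (z₂ == w))) ≡⟨ sum-cong-≗ pointwise ⟩
        ∣ (λ (_ : Fin n) → true) ∣ ∎
        where
        open ≡-Reasoning
        pointwise : ∀ w → ι (S w) + (ι (z₁ == w) + ι (z₂ == w)) ≡ 1
        pointwise w with z₁ ≟ w | z₂ ≟ w
        ... | yes p | yes q = contradiction (trans p (sym q)) z₁≢z₂
        ... | yes _ | no _ = refl
        ... | no _ | yes _ = refl
        ... | no _ | no _ = refl

    -- The arcs u → N v and v → N³ u split the Hamiltonian cycle without z₁ = N u and z₂ = N² u
    -- into the cycles A through N³ u, …, v and B through N v, …, u.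
    module Split (chordless : ∀ w → E w (N (N (N w))) ≡ false) (u v : Fin n)
      (uv : E u (N v) ≡ true) (vw : E v (N (N (N u))) ≡ true) (v≢u : ¬ (v ≡ u)) (v≢z₂ : ¬ (v ≡ N (N u)))
      (v≢mid : ¬ (v ≡ iterate N (N u) (suc (2 * k)))) where

      open Position (P u)

      z₁ z₂ : Fin n
      z₁ = N u
      z₂ = N z₁

      j : ℕ
      j = pos v

      pos-z₁ : pos z₁ ≡ 0
      pos-z₁ = pos-at 0 (≤-trans (s≤s z≤n) 8≤2a)
      pos-z₂ : pos z₂ ≡ 1
      pos-z₂ = pos-at 1 (≤-trans (s≤s (s≤s z≤n)) 8≤2a)
      pos-w : pos (N z₂) ≡ 2
      pos-w = pos-at 2 (≤-trans (s≤s (s≤s (s≤s z≤n))) 8≤2a)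

      last : ℕ
      last = 2 * a ∸ 1
      2a≡ : 2 * a ≡ suc last
      2a≡ = sym (m+[n∸m]≡n (≤-trans (s≤s z≤n) 8≤2a))
      pos≤last : ∀ w → pos w ≤ last
      pos≤last w = s≤s⁻¹ (subst (pos w <_) 2a≡ (pos< w))

      side-v : side v ≡ side u
      side-v = Bool.not-injective (trans (sym (flips v)) (bip u (N v) uv))

      -- By parity: `v` is on the side of `u`, whereas positions 0 and 2 belong to the other side,
      -- and position 1 is that of `z₂`.
      3≤j : 3 ≤ j
      3≤j = go j refl
        where
        go : ∀ i → j ≡ i → 3 ≤ i
        go 0 e = contradiction
          (trans (sym side-v)
          (trans (cong side (pos-injective v z₁ (trans e (sym pos-z₁)))) (flips u))) b≢not-b
        go 1 e = contradiction (pos-injective v z₂ (trans e (sym pos-z₂))) v≢z₂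
        go 2 e = contradiction
          (trans (sym side-v) (trans (cong side (pos-injective v (N z₂) (trans e (sym pos-w))))
          (trans (flips z₂)
            (trans (cong not (flips z₁)) (trans (Bool.not-involutive _) (flips u)))))) b≢not-b
        go (suc (suc (suc i))) e = s≤s (s≤s (s≤s z≤n))

      j<last : j < last
      j<last = ≤∧≢⇒< (pos≤last v) λ e → v≢u (pos-injective v u (trans e (sym (pos-last u))))

      -- By parity `v` is not the predecessor of `u`. This puts that predecessor into `B`, as
      -- `missing-B` requires.
      suc-j≢last : ¬ (suc j ≡ last)
      suc-j≢last e = b≢not-b (trans side-v (trans (cong side (sym Nv≡u)) (flips v)))
        where
        Nv≡u : N v ≡ u
        Nv≡u = pos-injective (N v) u
          (trans (pos-next v (subst (suc j <_) (sym 2a≡) (s≤s j<last))) (trans e (sym (pos-last u))))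

      -- The successors of `u`, `v` and `z₂` are rotated: `u ↦ N v`, `v ↦ N³ u` and `z₂ ↦ z₁`. The
      -- last one need not be an arc; it closes the two vertices left out to a 2-cycle of `M`.
      M : Fin n → Fin n
      M = N ∘ swap u v ∘ swap v z₂

      M-inj : Injective _≡_ _≡_ M
      M-inj = swap-injective v z₂ ∘ swap-injective u v ∘ inj

      u≢z₂ : ¬ (u ≡ z₂)
      u≢z₂ e = distinct-near u 2 0 (s≤s (s≤s (s≤s z≤n))) (s≤s z≤n) (λ ()) (cong N (sym e))

      M-u : M u ≡ N v
      M-u = cong N (trans (cong (swap u v) (swap-other v z₂ (v≢u ∘ sym) u≢z₂)) (swap-left u v))
      M-v : M v ≡ N z₂
      M-v = cong N (trans (cong (swap u v) (swap-left v z₂)) (swap-other u v (u≢z₂ ∘ sym) (v≢z₂ ∘ sym)))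
      M-z₂ : M z₂ ≡ z₁
      M-z₂ = cong N (trans (cong (swap u v) (swap-right v z₂)) (swap-right u v))
      M-other : ∀ w → ¬ (w ≡ u) → ¬ (w ≡ v) → ¬ (w ≡ z₂) → M w ≡ N w
      M-other w p q r = cong N (trans (cong (swap u v) (swap-other v z₂ q r)) (swap-other u v p q))

      side-z₂ : side z₂ ≡ side u
      side-z₂ = trans (flips z₁) (trans (cong not (flips u)) (Bool.not-involutive (side u)))

      M-flips : ∀ w → side (M w) ≡ not (side w)
      M-flips w = trans (flips _)
        (cong not (trans (swap-preserves side u v (sym side-v) _)
        (swap-preserves side v z₂ (trans side-v (sym side-z₂)) w)))

      A B R : Fin n → Bool
      A w = not (does (pos w <? 2)) ∧ does (pos w <? suc j)
      B w = not (does (pos w <? suc j))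
      R w = does (pos w <? 2)

      A-intro : ∀ w → 2 ≤ pos w → pos w ≤ j → A w ≡ true
      A-intro w p q rewrite dec-false (pos w <? 2) (≤⇒≯ p) | dec-true (pos w <? suc j) (s≤s q) = refl
      A-elim : ∀ w → A w ≡ true → 2 ≤ pos w × pos w ≤ j
      A-elim w w∈ with p , q ← ∧-split (not (does (pos w <? 2))) _ w∈ =
        ≮⇒≥ (¬does⇒ (pos w <? 2) (Bool.not-injective p)) , s≤s⁻¹ (does⇒ (pos w <? suc j) q)
      B-intro : ∀ w → j < pos w → B w ≡ true
      B-intro w p = cong not (dec-false (pos w <? suc j) (≤⇒≯ p))
      B-elim : ∀ w → B w ≡ true → j < pos w
      B-elim w w∈ = ≮⇒≥ (¬does⇒ (pos w <? suc j) (Bool.not-injective w∈))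
      R-intro : ∀ w → pos w < 2 → R w ≡ true
      R-intro w = dec-true (pos w <? 2)
      R-elim : ∀ w → R w ≡ true → pos w < 2
      R-elim w = does⇒ (pos w <? 2)

      pos≢ : ∀ {x y p q} → pos x ≡ p → pos y ≡ q → ¬ (p ≡ q) → ¬ (x ≡ y)
      pos≢ e₁ e₂ ne refl = ne (trans (sym e₁) e₂)

      A-next : ∀ w → A w ≡ true → ¬ (w ≡ v) → M w ≡ N w × pos (N w) ≡ suc (pos w) × A (N w) ≡ true
      A-next w w∈ w≢v with lo , hi ← A-elim w w∈ =
        M-other w (λ { refl → <⇒≱ j<last (subst (_≤ j) (pos-last u) hi) }) w≢v
          (λ { refl → 1+n≰n (subst (2 ≤_) pos-z₂ lo) }) ,
        next , A-intro (N w) (subst (2 ≤_) (sym next) (m≤n⇒m≤1+n lo)) (subst (_≤ j) (sym next) below)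
        where
        below : suc (pos w) ≤ j
        below = ≤∧≢⇒< (proj₂ (A-elim w w∈)) λ e → w≢v (pos-injective w v e)
        next : pos (N w) ≡ suc (pos w)
        next = pos-next w (≤-<-trans below (pos< v))

      reachA : ∀ d w → A w ≡ true → pos w + d ≡ j → ∃ λ i → iterate M w i ≡ v
      reachA zero w w∈ e = 0 , pos-injective w v (trans (sym (+-identityʳ _)) e)
      reachA (suc d) w w∈ e with q , p , N∈ ← A-next w w∈
        (λ { refl → m≢1+m+n j (sym (trans (sym (+-suc j d)) e)) })
        with i , e′ ← reachA d (N w) N∈ (trans (cong (_+ d) p) (trans (sym (+-suc (pos w) d)) e)) =
        suc i , trans (cong (λ x → iterate M x i) q) e′

      OA : Orbit M A
      OA .Orbit.root = v
      OA .Orbit.root∈ = A-intro v (≤-trans (n≤1+n 2) 3≤j) ≤-refl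
      OA .Orbit.closed w w∈ = case w ≟ v of λ
        { (yes refl) →
          trans (cong A M-v)
          (A-intro (N z₂) (≤-reflexive (sym pos-w))
          (≤-trans (≤-reflexive pos-w) (≤-trans (n≤1+n 2) 3≤j)))
        ; (no w≢v) → trans (cong A (proj₁ (A-next w w∈ w≢v))) (proj₂ (proj₂ (A-next w w∈ w≢v))) }
      OA .Orbit.reach w w∈ = reachA (j ∸ pos w) w w∈ (m+[n∸m]≡n (proj₂ (A-elim w w∈)))

      B-next : ∀ w → B w ≡ true → ¬ (w ≡ u) → M w ≡ N w × pos (N w) ≡ suc (pos w) × B (N w) ≡ true
      B-next w w∈ w≢u with lo ← B-elim w w∈ =
        M-other w w≢u (λ { refl → <-irrefl refl lo })
          (λ { refl → <⇒≱ lo (≤-trans (≤-reflexive pos-z₂) (≤-trans (m≤m+n 1 2) 3≤j)) }) ,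
        next , B-intro (N w) (subst (j <_) (sym next) (m<n⇒m<1+n lo))
        where
        next : pos (N w) ≡ suc (pos w)
        next = pos-next w
          (subst (suc (pos w) <_) (sym 2a≡)
          (s≤s (≤∧≢⇒< (pos≤last w) λ e → w≢u (pos-injective w u (trans e (sym (pos-last u)))))))

      reachB : ∀ d w → B w ≡ true → pos w + d ≡ last → ∃ λ i → iterate M w i ≡ u
      reachB zero w w∈ e =
        0 , pos-injective w u (trans (sym (+-identityʳ _)) (trans e (sym (pos-last u))))
      reachB (suc d) w w∈ e with q , p , N∈ ← B-next w w∈
        (λ { refl → m≢1+m+n last
        (sym (trans (sym (+-suc last d)) (trans (cong (_+ suc d) (sym (pos-last u))) e))) })
        with i , e′ ← reachB d (N w) N∈ (trans (cong (_+ d) p) (trans (sym (+-suc (pos w) d)) e)) =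
        suc i , trans (cong (λ x → iterate M x i) q) e′

      OB : Orbit M B
      OB .Orbit.root = u
      OB .Orbit.root∈ = B-intro u (subst (j <_) (sym (pos-last u)) j<last)
      OB .Orbit.closed w w∈ = case w ≟ u of λ
        { (yes refl) →
          trans (cong B M-u)
          (B-intro (N v) (≤-reflexive (sym (pos-next v (subst (suc j <_) (sym 2a≡) (s≤s j<last))))))
        ; (no w≢u) → trans (cong B (proj₁ (B-next w w∈ w≢u))) (proj₂ (proj₂ (B-next w w∈ w≢u))) }
      OB .Orbit.reach w w∈ = reachB (last ∸ pos w) w w∈ (m+[n∸m]≡n (pos≤last w))

      R-closed : ∀ w → R w ≡ true → R (M w) ≡ true
      R-closed w w∈ = go (pos w) refl (R-elim w w∈)
        where
        go : ∀ i → pos w ≡ i → i < 2 → R (M w) ≡ true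
        go 0 e _ with refl ← pos-injective w z₁ (trans e (sym pos-z₁)) =
          trans (cong R (M-other z₁ (λ q → b≢not-b (trans (cong side (sym q)) (flips u)))
            (λ q → n≮0 (subst (3 ≤_) (trans (cong pos (sym q)) pos-z₁) 3≤j))
            (pos≢ pos-z₁ pos-z₂ λ ())))
            (R-intro z₂ (≤-reflexive (cong suc pos-z₂)))
        go 1 e _ with refl ← pos-injective w z₂ (trans e (sym pos-z₂)) =
          trans (cong R M-z₂) (R-intro z₁ (subst (_< 2) (sym pos-z₁) (s≤s z≤n)))
        go (suc (suc i)) e (s≤s (s≤s ()))

      R⊆below : ∀ w → R w ≡ true → does (pos w <? suc j) ≡ true
      R⊆below w w∈ =
        dec-true (pos w <? suc j) (≤-trans (R-elim w w∈) (≤-trans (≤-trans (n≤1+n 2) 3≤j) (n≤1+n j)))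

      partition : ∀ w → ι (A w) + ι (B w) + ι (R w) ≡ 1
      partition w = go _ _ (R⊆below w)
        where
        go : ∀ p q → (p ≡ true → q ≡ true) → ι (not p ∧ q) + ι (not q) + ι p ≡ 1
        go true  q     f rewrite f refl = refl
        go false true  f = refl
        go false false f = refl

      partition′ : ∀ w → ι (B w) + ι (A w) + ι (R w) ≡ 1
      partition′ w = trans (cong (_+ ι (R w)) (+-comm (ι (B w)) (ι (A w)))) (partition w)

      A-M : ∀ w → A (M w) ≡ A w
      A-M = closed-back M-inj A (Orbit.closed OA)
      B-M : ∀ w → B (M w) ≡ B w
      B-M = closed-back M-inj B (Orbit.closed OB)

      size-R : ∣ R ∣ ≡ 2
      size-R = count-below 2 (≤-trans (s≤s (s≤s z≤n)) 8≤2a)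

      sized-R : Sized R 1
      sized-R with r , s ← sized-closed M-inj M-flips R (closed-back M-inj R R-closed) =
        subst (Sized R) (*-cancelˡ-≡ r 1 2 (trans (sym (sized-∣∣ R s)) size-R)) s

      size-A : ∣ A ∣ + 2 ≡ suc j
      size-A = begin
        ∣ A ∣ + 2 ≡⟨ cong (∣ A ∣ +_) size-R ⟨
        ∣ A ∣ + ∣ R ∣ ≡⟨ ∑-distrib-+ (ι ∘ A) (ι ∘ R) ⟨
        ∑[ w < n ] (ι (A w) + ι (R w)) ≡⟨ sum-cong-≗ pointwise ⟩
        ∑[ w < n ] ι (does (pos w <? suc j)) ≡⟨ count-below (suc j) (pos< v) ⟩
        suc j ∎
        where
        open ≡-Reasoning
        pointwise : ∀ w → ι (A w) + ι (R w) ≡ ι (does (pos w <? suc j))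
        pointwise w = go _ _ (R⊆below w)
          where
          go : ∀ p q → (p ≡ true → q ≡ true) → ι (not p ∧ q) + ι p ≡ ι q
          go true  q f rewrite f refl = refl
          go false q f = +-identityʳ (ι q)

      -- As `A` occupies the positions from 2 to `j`, size `2k` means `j = 2k + 1`, which is the
      -- origin of the index in `v≢mid`.
      not-mid : ∀ {m} → Sized A m → ¬ (m ≡ k)
      not-mid {m} s refl =
        v≢mid (trans (sym (at v))
        (cong (iterate N (N u))
        (suc-injective (trans (sym size-A) (trans (cong (_+ 2) (sized-∣∣ A s)) (+-comm (2 * k) 2))))))

      cnt-bound : ∀ S T {m t} → Sized S m → Sized T t → cnt E S T ≤ 2 * m * t
      cnt-bound S T {t = t} s t′ =
        ≤-trans (cnt-E≤opp S T) (≤-reflexive (trans (cnt-opp S T t′) (cong (_* t) (sized-∣∣ S s))))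

      cnt-bound-strict : ∀ S T {m t} → Sized S m → Sized T t → ∀ x → S x ≡ true →
        T (N (N (N x))) ≡ true → cnt E S T + 1 ≤ 2 * m * t
      cnt-bound-strict S T {t = t} s t′ x x∈ y∈ = ≤-trans
        (cnt-missing S T x (N (N (N x))) x∈ y∈
          (flip⇒opp x _
          (trans (flips _) (trans (cong not (flips _)) (trans (Bool.not-involutive _) (flips x)))))
          (chordless x))
        (≤-reflexive (trans (cnt-opp S T t′) (cong (_* t) (sized-∣∣ S s))))

      -- The absent arc is `z₁ → N³ z₁`; its head has position 3 and lies in `A` because `3 ≤ j`.
      missing-A : ∀ {m} → Sized A m → cnt E A R + cnt E R A + 1 ≤ 4 * m * 1
      missing-A {m} s = ≤-trans (≤-reflexive (+-assoc (cnt E A R) _ 1)) (≤-trans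
        (+-mono-≤ (cnt-bound A R s sized-R) (cnt-bound-strict R A sized-R s z₁
          (R-intro z₁ (subst (_< 2) (sym pos-z₁) (s≤s z≤n)))
          (A-intro (N (N z₂)) (subst (2 ≤_) (sym pos-3) (n≤1+n 2)) (subst (_≤ j) (sym pos-3) 3≤j))))
        (≤-reflexive (eq m)))
        where
        pos-3 : pos (N (N z₂)) ≡ 3
        pos-3 = pos-at 3 (≤-trans (s≤s (s≤s (s≤s (s≤s z≤n)))) 8≤2a)
        eq : ∀ m → 2 * m * 1 + 2 * 1 * m ≡ 4 * m * 1
        eq = solve-∀

      -- The absent arc is `x → z₂` for the predecessor `x` of `u`, as `N³ x = z₂`.
      missing-B : ∀ {m} → Sized B m → cnt E B R + cnt E R B + 1 ≤ 4 * m * 1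
      missing-B {m} s = ≤-trans (≤-reflexive (eq₀ (cnt E B R) (cnt E R B))) (≤-trans
        (+-mono-≤ (cnt-bound-strict B R s sized-R x (B-intro x (subst (j <_) (sym pos-x) j<pl))
          (trans (cong (λ y → R (N (N y))) Nx≡u) (R-intro z₂ (≤-reflexive (cong suc pos-z₂)))))
          (cnt-bound R B sized-R s))
        (≤-reflexive (eq m)))
        where
        pl : ℕ
        pl = last ∸ 1
        last≡ : last ≡ suc pl
        last≡ = sym (m+[n∸m]≡n (≤-trans (s≤s z≤n) j<last))
        j<pl : j < pl
        j<pl = s≤s⁻¹ (subst (suc j <_) last≡ (≤∧≢⇒< j<last suc-j≢last))
        x : Fin n
        x = iterate N (N u) pl
        pos-x : pos x ≡ pl
        pos-x = pos-at pl (subst (pl <_) (sym (trans 2a≡ (cong suc last≡))) (≤-trans (n≤1+n _) ≤-refl))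
        Nx≡u : N x ≡ u
        Nx≡u = pos-injective (N x) u
          (trans (pos-next x
          (subst₂ _<_ (cong suc (sym pos-x)) (sym (trans 2a≡ (cong suc last≡))) ≤-refl))
          (trans (cong suc pos-x) (trans (sym last≡) (sym (pos-last u)))))
        eq₀ : ∀ x y → x + y + 1 ≡ x + 1 + y
        eq₀ = solve-∀
        eq : ∀ m → 2 * m * 1 + 2 * 1 * m ≡ 4 * m * 1
        eq = solve-∀

      -- The count, applied to the smaller of `A` and `B`, would give both of them size `2k`,
      -- contrary to `not-mid`.
      mergeable : Unmergeable M A B → ⊥
      mergeable un with m , s ← sized-closed M-inj M-flips A A-M
          with t , s′ ← sized-closed M-inj M-flips B B-M
          with ≤-total m t
      ... | inj₁ m≤t =
        not-mid s (proj₁ (unmergeable-sizes M-inj M-flips A B R A-M B-M un partition s s′ sized-R ≤-refl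
              (sized-positive A s v (Orbit.root∈ OA)) m≤t (missing-A s)))
      ... | inj₂ t≤m =
        not-mid s (proj₂
        (unmergeable-sizes M-inj M-flips B A R B-M A-M (λ x y x∈ y∈ e e′ → un y x y∈ x∈ e′ e)
              partition′ s′ s sized-R ≤-refl (sized-positive B s′ u (Orbit.root∈ OB)) t≤m
                (missing-B s′)))

      disjoint : ∀ w → A w ≡ true → B w ≡ true → ⊥
      disjoint w w∈ w∈′ = <⇒≱ (B-elim w w∈′) (proj₂ (A-elim w w∈))

      arcsAB : ∀ w → A w ∨ B w ≡ true → E w (M w) ≡ true
      arcsAB w w∈ = case w ≟ u of λ
        { (yes refl) → trans (cong (E u) M-u) uv
        ; (no w≢u) → case w ≟ v of λ
          { (yes refl) → trans (cong (E v) M-v) vw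
          ; (no w≢v) → trans (cong (E w) (M≡N w≢u w≢v)) (arcs w) } }
        where
        M≡N : ¬ (w ≡ u) → ¬ (w ≡ v) → M w ≡ N w
        M≡N w≢u w≢v with ∨-split (A w) (B w) w∈
        ... | inj₁ p = proj₁ (A-next w p w≢v)
        ... | inj₂ p = proj₁ (B-next w p w≢u)

      preHamiltonian : PreHamiltonian
      preHamiltonian with any? (λ s → any? λ t → (A s Bool.≟ true) ×-dec (B t Bool.≟ true)
        ×-dec (E s (M t) Bool.≟ true) ×-dec (E t (M s) Bool.≟ true))
      ... | no none = ⊥-elim (mergeable λ s t p q e e′ → none (s , t , p , q , e , e′))
      ... | yes (s , t , s∈ , t∈ , st , ts) = record
        { M = G.merged ; inj = G.merged-injective ; S = λ w → A w ∨ B w ; orbit = G.merged-orbit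
        ; flips = λ w → trans (M-flips _) (cong not (swap-preserves side s t same-side w))
        ; arcs = arcsG ; size = trans sizes size-all }
        where
        module G = Merge M-inj OA OB disjoint s t s∈ t∈
        same-side : side s ≡ side t
        same-side = Bool.not-injective (trans (sym (bip s (M t) st)) (M-flips t))
        arcsG : ∀ w → A w ∨ B w ≡ true → E w (G.merged w) ≡ true
        arcsG w w∈ = case w ≟ s of λ
          { (yes refl) → trans (cong (λ x → E s (M x)) (swap-left s t)) st
          ; (no w≢s) → case w ≟ t of λ
            { (yes refl) → trans (cong (λ x → E t (M x)) (swap-right s t)) ts
            ; (no w≢t) → trans (cong (λ x → E w (M x)) (swap-other s t w≢s w≢t)) (arcsAB w w∈) } }
        sizes : ∣ (λ w → A w ∨ B w) ∣ + 2 ≡ ∣ (λ (_ : Fin n) → true) ∣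
        sizes = begin
          ∣ (λ w → A w ∨ B w) ∣ + 2 ≡⟨ cong (∣ (λ w → A w ∨ B w) ∣ +_) size-R ⟨
          ∣ (λ w → A w ∨ B w) ∣ + ∣ R ∣ ≡⟨ cong (_+ ∣ R ∣) (∣∣-disjoint A B disjoint) ⟩
          ∣ A ∣ + ∣ B ∣ + ∣ R ∣ ≡⟨ cong (_+ ∣ R ∣) (∑-distrib-+ (ι ∘ A) (ι ∘ B)) ⟨
          ∑[ w < n ] (ι (A w) + ι (B w)) + ∣ R ∣ ≡⟨ ∑-distrib-+ (λ w → ι (A w) + ι (B w)) (ι ∘ R) ⟨
          ∑[ w < n ] (ι (A w) + ι (B w) + ι (R w)) ≡⟨ sum-cong-≗ partition ⟩
          ∣ (λ (_ : Fin n) → true) ∣ ∎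
          where open ≡-Reasoning

    module Search (chordless : ∀ w → E w (N (N (N w))) ≡ false)
      (none : ∀ u v → E u (N v) ≡ true → E v (N (N (N u))) ≡ true → ¬ (v ≡ u) → ¬ (v ≡ N (N u)) →
        v ≡ iterate N (N u) (suc (2 * k))) where

      open ≤-Reasoning

      mid : Fin n → Fin n
      mid u = iterate N (N u) (suc (2 * k))

      to-same : ∀ u v x → E u x ≡ true → side x ≡ not (side v) → same u v ≡ true
      to-same u v x e e′ = go (side u) (side v) (Bool.not-injective (trans (sym (bip u x e)) e′))
        where
        go : ∀ b c → b ≡ c → not b xor c ≡ true
        go true  _ refl = refl
        go false _ refl = refl

      same-sym : ∀ u v → same u v ≡ same v u
      same-sym u v = trans (sym (Bool.not-distribˡ-xor (side u) (side v)))
        (trans (cong not (opp-sym u v)) (Bool.not-distribˡ-xor (side v) (side u)))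

      flips³ : ∀ u → side (N (N (N u))) ≡ not (side u)
      flips³ u = trans (flips _) (trans (cong not (flips _)) (trans (Bool.not-involutive _) (flips u)))

      -- For `v = u` and for `v = N² u`, one of the two arcs would be the excluded `u → N³ u`.
      both : ∀ u v → E u (N v) ≡ true → E v (N (N (N u))) ≡ true → v ≡ mid u
      both u v e e′ =
        none u v e e′ (λ { refl → true≢false e′ (chordless u) })
        (λ { refl → true≢false e (chordless u) })

      pair-bound : ∀ u v → ι (E u (N v)) + ι (E v (N (N (N u)))) ≤ ι (same u v) + ι (mid u == v)
      pair-bound u v = go _ _ refl refl
        where
        go : ∀ b c → E u (N v) ≡ b → E v (N (N (N u))) ≡ c → ι b + ι c ≤ ι (same u v) + ι (mid u == v)
        go false false _ _ = z≤n
        go true false e _ rewrite to-same u v _ e (flips v) = s≤s z≤n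
        go false true _ e rewrite trans (same-sym u v) (to-same v u _ e (flips³ u)) = s≤s z≤n
        go true true e e′ rewrite to-same u v _ e (flips v) | both u v e e′ | ==-refl (mid u) = ≤-refl

      -- Reindexing the out-arcs of `u` by `N` pairs `u → N v` with `v → N³ u` for each of the `a`
      -- vertices `v` beside `u`. Only for `v = mid u` can both be present, which accounts for the
      -- extra 1.
      vertex-bound : ∀ u → outdegree u + indegree (N (N (N u))) ≤ a + 1
      vertex-bound u = begin
        outdegree u + indegree (N (N (N u)))
          ≡⟨ cong (_+ indegree (N (N (N u)))) (sum-reindex inj (λ v → ι (E u v))) ⟩
        ∑[ v < n ] ι (E u (N v)) + indegree (N (N (N u)))
          ≡⟨ ∑-distrib-+ (λ v → ι (E u (N v))) (λ v → ι (E v (N (N (N u))))) ⟨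
        ∑[ v < n ] (ι (E u (N v)) + ι (E v (N (N (N u))))) ≤⟨ sum-mono (pair-bound u) ⟩
        ∑[ v < n ] (ι (same u v) + ι (mid u == v))
          ≡⟨ ∑-distrib-+ (λ v → ι (same u v)) (λ v → ι (mid u == v)) ⟩
        ∑[ v < n ] ι (same u v) + ∑[ v < n ] ι (mid u == v)
          ≡⟨ cong₂ _+_ (balanced (not (side u))) (sum-==ʳ (mid u)) ⟩
        a + 1 ∎

      -- Shifting the in-degrees along `N³` keeps their sum, so the average degree would be at most
      -- `a + 1`, less than `a + k`.
      impossible : Fin n → ⊥
      impossible v = <⇒≱ (sum-strict) (begin
        ∑[ u < n ] degree u ≡⟨ ∑-distrib-+ outdegree indegree ⟩
        sum outdegree + sum indegree
          ≡⟨ cong (sum outdegree +_)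
          (trans (sum-reindex inj indegree)
          (trans (sum-reindex inj (indegree ∘ N)) (sum-reindex inj (λ u → indegree (N (N u)))))) ⟩
        sum outdegree + ∑[ u < n ] indegree (N (N (N u)))
          ≡⟨ ∑-distrib-+ outdegree (λ u → indegree (N (N (N u)))) ⟨
        ∑[ u < n ] (outdegree u + indegree (N (N (N u)))) ≤⟨ sum-mono vertex-bound ⟩
        ∑[ u < n ] (a + 1) ∎)
        where
        slack : ∀ u → a + 1 + 1 ≤ degree u
        slack u = ≤-trans (≤-reflexive (+-assoc a 1 1)) (≤-trans (+-monoʳ-≤ a 2≤k) (minDegree u))
        sum-strict : ∑[ u < n ] (a + 1) < ∑[ u < n ] degree u
        sum-strict = ≤-trans (≤-reflexive (+-comm 1 _))
          (sum-mono-at 1 (λ u → ≤-trans (m≤m+n (a + 1) 1) (slack u)) v (slack v))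

    preHamiltonian : Fin n → PreHamiltonian
    preHamiltonian v₀ with any? (λ w → E w (N (N (N w))) Bool.≟ true)
    ... | yes (w , e) = chord w e
    ... | no no-chord with any?
      (λ u → any? λ v → (E u (N v) Bool.≟ true) ×-dec (E v (N (N (N u))) Bool.≟ true)
        ×-dec ¬? (v ≟ u) ×-dec ¬? (v ≟ N (N u)) ×-dec ¬? (v ≟ iterate N (N u) (suc (2 * k))))
    ...   | yes (u , v , p₁ , p₂ , p₃ , p₄ , p₅) =
      Split.preHamiltonian (λ w → not-true⇒false λ e → no-chord (w , e)) u v p₁ p₂ p₃ p₄ p₅
    ...   | no none = ⊥-elim (Search.impossible (λ w → not-true⇒false λ e → no-chord (w , e))
      (λ u v p₁ p₂ p₃ p₄ → decidable-stable (v ≟ _) λ p₅ → none (u , v , p₁ , p₂ , p₃ , p₄ , p₅)) v₀)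

-- Cycles of all even lengths

module Cycles {n} (E : Fin n → Fin n → Bool) where

  Cycle : ℕ → (ℕ → Fin n) → Set
  Cycle m c = (∀ i j → i < m → j < m → c i ≡ c j → i ≡ j) ×
    (∀ i → suc i < m → E (c i) (c (suc i)) ≡ true) × (∀ i → suc i ≡ m → E (c i) (c 0) ≡ true)

  position-cycle : ∀ {N b L} → Position N b L → (∀ v → E v (N v) ≡ true) → Cycle L (iterate N b)
  position-cycle {N} {b} {L} P arcs =
    (λ i j i< j< e → trans (sym (pos-at i i<)) (trans (cong pos e) (pos-at j j<))) ,
    (λ i _ → trans (cong (E _) (iterate-suc N b i)) (arcs _)) ,
    (λ i e → trans
      (cong (E _) (trans (sym return) (trans (cong (iterate N b) (sym e)) (iterate-suc N b i))))
      (arcs _))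
    where open Position P

module ShortCycles {n} {E : Fin n → Fin n → Bool} {side : Fin n → Bool}
  {bip : ∀ u v → E u v ≡ true → side v ≡ not (side u)} {a k δ h : ℕ}
  (conditions : Conditions E side bip a k δ h) where

  open Main conditions
  open PreHamiltonCycle conditions using (PreHamiltonian; size-all)
  open Cycles E

  module _ (H : PreHamiltonian) where

    open PreHamiltonian H

    S-M : ∀ v → S (M v) ≡ S v
    S-M = closed-back inj S (Orbit.closed orbit)

    outside : ∃ λ x → S x ≡ false
    outside with any? (λ x → S x Bool.≟ false)
    ... | yes p = p
    ... | no none = contradiction (begin
      2 * a + 2 ≡⟨ cong (_+ 2) size-all ⟨
      ∣ (λ (_ : Fin n) → true) ∣ + 2
        ≤⟨ +-monoˡ-≤ 2 (sum-mono λ x → ≤-reflexive (cong ι (sym (Bool.¬-not λ e → none (x , e))))) ⟩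
      ∣ S ∣ + 2 ≡⟨ size ⟩
      2 * a ∎) (<⇒≱ (m<m+n (2 * a) (s≤s z≤n)))
      where open ≤-Reasoning

    sized-S : ∃ λ t → Sized S t × t + 1 ≡ a
    sized-S with t , s ← sized-closed inj flips S S-M = t , s , *-cancelˡ-≡ (t + 1) a 2
      (trans (*-distribˡ-+ 2 t 1) (trans (cong (_+ 2) (sym (sized-∣∣ S s))) size))

    x : Fin n
    x = proj₁ outside

    iterate-S : ∀ i v → S (iterate M v i) ≡ S v
    iterate-S zero v = refl
    iterate-S (suc i) v = trans (iterate-S i (M v)) (S-M v)

    iterate-side : ∀ i v → side (iterate M v (2 * i)) ≡ side v
    iterate-side zero v = refl
    iterate-side (suc i) v rewrite +-suc i (i + 0) =
      trans (iterate-side i (M (M v)))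
        (trans (flips (M v)) (trans (cong not (flips v)) (Bool.not-involutive (side v))))

    -- Otherwise, reindexing the in-arcs of x along iterate M _ (2 i) bounds the degree of x by |S|/2 + 2.
    chord-pair : ∀ i → ∃ λ w → S w ≡ true × E x w ≡ true × E (iterate M w (2 * i)) x ≡ true
    chord-pair i with any?
      (λ w → (S w Bool.≟ true) ×-dec (E x w Bool.≟ true) ×-dec (E (iterate M w (2 * i)) x Bool.≟ true))
    ... | yes p = p
    ... | no none with t , s , t+1 ← sized-S = contradiction (begin
      a + 2 ≤⟨ +-monoʳ-≤ a 2≤k ⟩
      a + k ≤⟨ minDegree x ⟩
      outdegree x + indegree x ≤⟨ +-mono-≤ (sum-mono out) (sum-mono inn) ⟩
      sum (λ w → ι (S w ∧ E x w) + ι (∁S w ∧ opp x w)) + sum (λ w → ι (S w ∧ E w x) + ι (∁S w ∧ opp x w))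
        ≡⟨ cong₂ _+_ (∑-distrib-+ (λ w → ι (S w ∧ E x w)) rest)
          (∑-distrib-+ (λ w → ι (S w ∧ E w x)) rest) ⟩
      (sum (λ w → ι (S w ∧ E x w)) + sum rest) + (sum (λ w → ι (S w ∧ E w x)) + sum rest)
        ≡⟨ cong₂ (λ p q → (sum (λ w → ι (S w ∧ E x w)) + p) + (sum (λ w → ι (S w ∧ E w x)) + q)) rest≡1
          rest≡1 ⟩
      (sum (λ w → ι (S w ∧ E x w)) + 1) + (sum (λ w → ι (S w ∧ E w x)) + 1)
        ≡⟨ eq (sum (λ w → ι (S w ∧ E x w))) (sum (λ w → ι (S w ∧ E w x))) ⟩
      sum (λ w → ι (S w ∧ E x w)) + sum (λ w → ι (S w ∧ E w x)) + 2 ≤⟨ +-monoˡ-≤ 2 pairs ⟩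
      t + 2 ∎) (<⇒≱ (+-monoˡ-< 2 (subst (t <_) t+1 (m<m+n t (s≤s z≤n)))))
      where
      open ≤-Reasoning
      eq : ∀ p q → (p + 1) + (q + 1) ≡ p + q + 2
      eq = solve-∀
      ∁S : Fin n → Bool
      ∁S w = not (S w)
      rest : Fin n → ℕ
      rest w = ι (∁S w ∧ opp x w)
      -- Each side has `a` vertices, and `S` takes `a - 1` of them.
      rest≡1 : sum rest ≡ 1
      rest≡1 = +-cancelˡ-≡ t _ _ (trans (cong (_+ sum rest) (sym (s (side x))))
        (trans (sym (∑-distrib-+ (λ w → ι (S w ∧ opp x w)) rest))
          (trans (sum-cong-≗ glue) (trans (balanced (side x)) (sym t+1)))))
        where
        glue : ∀ w → ι (S w ∧ opp x w) + rest w ≡ ι (opp x w)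
        glue w with S w
        ... | true  = +-identityʳ _
        ... | false = refl
      out : ∀ w → ι (E x w) ≤ ι (S w ∧ E x w) + ι (∁S w ∧ opp x w)
      out w with S w
      ... | true  = m≤m+n _ _
      ... | false = ιE≤ιopp x w
      inn : ∀ w → ι (E w x) ≤ ι (S w ∧ E w x) + ι (∁S w ∧ opp x w)
      inn w with S w
      ... | true  = m≤m+n _ _
      ... | false = ≤-trans (ιE≤ιopp w x) (≤-reflexive (cong ι (opp-sym w x)))
      step : Fin n → Fin n
      step w = iterate M w (2 * i)
      pair : ∀ w → ι (S w ∧ E x w) + ι (S (step w) ∧ E (step w) x) ≤ ι (S w ∧ opp x w)
      pair w rewrite iterate-S (2 * i) w = go (S w) (E x w) (E (step w) x) refl refl refl
        where
        go : ∀ p q r → S w ≡ p → E x w ≡ q → E (step w) x ≡ r → ι (p ∧ q) + ι (p ∧ r) ≤ ι (p ∧ opp x w)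
        go false q r _ _ _ = z≤n
        go true true true p q r = contradiction (w , p , q , r) none
        go true true false p q r rewrite E⇒opp x w q = ≤-refl
        go true false true p q r =
          ≤-reflexive (cong
          ι (sym (trans (opp-sym x w)
          (trans (cong (_xor side x) (sym (iterate-side i w))) (E⇒opp (step w) x r)))))
        go true false false p q r = z≤n
      pairs : sum (λ w → ι (S w ∧ E x w)) + sum (λ w → ι (S w ∧ E w x)) ≤ t
      pairs = begin
        sum (λ w → ι (S w ∧ E x w)) + sum (λ w → ι (S w ∧ E w x))
          ≡⟨ cong (sum (λ w → ι (S w ∧ E x w)) +_)
            (sum-reindex (iterate-injective inj (2 * i)) (λ w → ι (S w ∧ E w x))) ⟩
        sum (λ w → ι (S w ∧ E x w)) + sum (λ w → ι (S (step w) ∧ E (step w) x))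
          ≡⟨ ∑-distrib-+ (λ w → ι (S w ∧ E x w)) (λ w → ι (S (step w) ∧ E (step w) x)) ⟨
        sum (λ w → ι (S w ∧ E x w) + ι (S (step w) ∧ E (step w) x)) ≤⟨ sum-mono pair ⟩
        sum (λ w → ι (S w ∧ opp x w)) ≡⟨ s (side x) ⟩
        t ∎

    -- The cycle runs `x, w, M w, …, M^(2i) w` and back to `x`. Its `2i + 1` vertices on `S` are
    -- distinct since `i + 1 < a` gives `2i + 2 ≤ ∣ S ∣`.
    short-cycle : ∀ i → suc i < a → Σ (ℕ → Fin n) (Cycle (2 * suc i))
    short-cycle i i<a with w , w∈ , xw , wx ← chord-pair i = c , c-inj , c-arcs , c-close
      where
      module T = Traversal inj orbit w w∈
      c : ℕ → Fin n
      c zero    = x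
      c (suc j) = iterate M w j
      length≡ : 2 * suc i ≡ suc (suc (2 * i))
      length≡ = *-suc 2 i
      long : 2 * suc i ≤ ∣ S ∣
      long = +-cancelʳ-≤ 2 _ _
        (≤-trans (≤-reflexive (trans (+-comm (2 * suc i) 2) (sym (*-suc 2 (suc i)))))
        (≤-trans (*-monoʳ-≤ 2 i<a) (≤-reflexive (sym size))))
      x∉ : ∀ j → ¬ (x ≡ iterate M w j)
      x∉ j e = true≢false (trans (iterate-S j w) w∈) (trans (cong S (sym e)) (proj₂ outside))
      c-inj : ∀ j l → j < 2 * suc i → l < 2 * suc i → c j ≡ c l → j ≡ l
      c-inj zero zero _ _ _ = refl
      c-inj zero (suc l) _ _ e = contradiction e (x∉ l)
      c-inj (suc j) zero _ _ e = contradiction (sym e) (x∉ j)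
      c-inj (suc j) (suc l) j< l< e =
        cong suc (T.distinct j l (<-≤-trans (<⇒≤ j<) long) (<-≤-trans (<⇒≤ l<) long) e)
      c-arcs : ∀ j → suc j < 2 * suc i → E (c j) (c (suc j)) ≡ true
      c-arcs zero _ = xw
      c-arcs (suc j) _ =
        trans (cong (E (iterate M w j)) (iterate-suc M w j)) (arcs _ (trans (iterate-S j w) w∈))
      c-close : ∀ j → suc j ≡ 2 * suc i → E (c j) (c 0) ≡ true
      c-close zero e = contradiction (suc-injective (trans e length≡)) λ ()
      c-close (suc j) e =
        trans (cong (λ l → E (iterate M w l) x) (suc-injective (suc-injective (trans e length≡)))) wx

  even-cycle : Fin n → ∀ m → 1 ≤ m → m ≤ a → Σ (ℕ → Fin n) (Cycle (2 * m))
  even-cycle v (suc i) _ m≤a = case m≤n⇒m<n∨m≡n m≤a of λ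
    { (inj₁ m<a) →
      short-cycle (PreHamiltonCycle.preHamiltonian conditions (HC.Factor.inj F)
      (HC.Factor.arcs F) O v) i m<a
    ; (inj₂ refl) → _ , position-cycle (position (HC.Factor.inj F) O v size-all) (HC.Factor.arcs F) }
    where
    module HC = HamiltonCycle conditions
    F : HC.Factor
    F = proj₁ (HC.hamiltonian v)
    all∈ : ∀ w → HC.Factor.S F w ≡ true
    all∈ = proj₂ (HC.hamiltonian v)
    O : Orbit (HC.Factor.N F) (λ _ → true)
    O = record { closed = λ _ _ → refl ; root = Orbit.root (HC.Factor.orbit F) ; root∈ = refl
               ; reach = λ w _ → Orbit.reach (HC.Factor.orbit F) w (all∈ w) }

-- Digraphs with a vertex of degree below a + k

module LowDegree {n} (E : Fin n → Fin n → Bool) (side : Fin n → Bool)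
  (bip : ∀ u v → E u v ≡ true → side v ≡ not (side u)) {a k : ℕ}
  (balanced : Bipartite.Sized E side bip (λ _ → true) a) (2≤k : 2 ≤ k) (1≤a : 1 ≤ a)
  (pairs : ∀ u v w → E u w ≡ true → E v w ≡ true → ¬ (u ≡ v) → a + k ≤ Bipartite.degree E side bip u)
  (strong : ∀ (S : Fin n → Bool) u v → S u ≡ true → S v ≡ false → ∃ λ x → ∃ λ y →
    S x ≡ true × S y ≡ false × E x y ≡ true)
  (u₀ : Fin n) (u₀-low : Bipartite.degree E side bip u₀ < a + k) where

  open Bipartite E side bip
  open Cycles E

  bad? : ∀ u → Dec (degree u < a + k)
  bad? u = degree u <? a + k

  -- With `u` as its only in-neighbour, `v` has degree at most `a + 1`, and `k ≥ 2` keeps this below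
  -- `a + k`.
  bad-next : ∀ u v → degree u < a + k → E u v ≡ true → degree v < a + k
  bad-next u v bad e = begin-strict
    outdegree v + indegree v
      ≤⟨ +-mono-≤ (outdegree≤ balanced v)
      (sum-unique (λ w → E w v) λ w w′ p q → trans (only w p) (sym (only w′ q))) ⟩
    a + 1 <⟨ +-monoʳ-< a 2≤k ⟩
    a + k ∎
    where
    open ≤-Reasoning
    only : ∀ w → E w v ≡ true → w ≡ u
    only w p with u ≟ w
    ... | yes q = sym q
    ... | no q = contradiction (pairs u w v e p q) (<⇒≱ bad)

  all-bad : ∀ u → degree u < a + k
  all-bad u = decidable-stable (bad? u) λ good →
    case strong (λ w → does (bad? w)) u₀ u (dec-true (bad? u₀) u₀-low) (dec-false (bad? u) good) of λ
      { (x , y , x∈ , y∉ , e) → ¬does⇒ (bad? y) y∉ (bad-next x y (does⇒ (bad? x) x∈) e) }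

  unique-pred : ∀ u v w → E u w ≡ true → E v w ≡ true → u ≡ v
  unique-pred u v w p q = decidable-stable (u ≟ v) λ u≢v → <⇒≱ (all-bad u) (pairs u v w p q u≢v)

  -- An arc crosses the cut around `u` alone, because some vertex on the opposite side lies outside
  -- it.
  successor : ∀ u → ∃ λ v → E u v ≡ true
  successor u with w , ow ← sum-witness (λ w → ι (opp u w)) (subst (1 ≤_) (sym (balanced (side u))) 1≤a)
    with x , y , x∈ , _ , e ← strong (u ==_) u w (==-refl u)
      (dec-false (u ≟ w) λ { refl → true≢false (ι-witness ow) (Bool.xor-same (side u)) })
    = y , subst (λ z → E z y ≡ true) (sym (==⇒≡ x∈)) e

  N : Fin n → Fin n
  N u = proj₁ (successor u)

  N-arcs : ∀ u → E u (N u) ≡ true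
  N-arcs u = proj₂ (successor u)

  N-inj : Injective _≡_ _≡_ N
  N-inj {u} {v} e = unique-pred u v (N v) (trans (cong (E u) (sym e)) (N-arcs u)) (N-arcs v)

  -- Since `N` is a permutation, `v` already receives an arc from its predecessor under `N`, and
  -- in-neighbours are unique.
  N-unique : ∀ u v → E u v ≡ true → N u ≡ v
  N-unique u v e = trans (cong N (unique-pred u (inverse N-inj v) v e
    (trans (cong (E (inverse N-inj v)) (sym (inverseʳ N-inj v))) (N-arcs _)))) (inverseʳ N-inj v)

  all∈ : ∀ u → orbitOf N-inj u₀ u ≡ true
  all∈ u = Bool.¬-not λ u∉ → case strong (orbitOf N-inj u₀) u₀ u (orbitOf-self N-inj u₀) u∉ of λ
    { (x , y , x∈ , y∉ , e) → true≢false
        (trans (cong (orbitOf N-inj u₀) (sym (N-unique x y e)))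
          (Orbit.closed (orbitOf-orbit N-inj u₀) x x∈)) y∉ }

  traversal : Position N u₀ (2 * a)
  traversal = position N-inj
    (record { closed = λ _ _ → refl ; root = Orbit.root O ; root∈ = refl ; reach =
    λ w _ → Orbit.reach O w (all∈ w) })
    u₀ (sized-∣∣ (λ _ → true) balanced)
    where O = orbitOf-orbit N-inj u₀

-- Passage from the given definitions to digraphs on Fin (a + a)

sucMod-suc : ∀ {m} (i : Fin m) → suc (toℕ i) < m → toℕ (sucMod i) ≡ suc (toℕ i)
sucMod-suc {suc m} i lt = trans (Fin.toℕ-fromℕ< _) (m<n⇒m%n≡m lt)

sucMod-last : ∀ {m} (i : Fin m) → suc (toℕ i) ≡ m → toℕ (sucMod i) ≡ 0
sucMod-last {suc m} i e = trans (Fin.toℕ-fromℕ< _) (trans (cong (λ x → x % suc m) e) (n%n≡0 (suc m)))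

countF≡sum : ∀ {n} (f : Fin n → Bool) → countF f ≡ ∣ f ∣
countF≡sum {zero} f = refl
countF≡sum {suc n} f with f Fin.zero
... | true  = cong suc (countF≡sum (f ∘ Fin.suc))
... | false = countF≡sum (f ∘ Fin.suc)

sum-split : ∀ a {b} (f : Fin (a + b) → ℕ) → sum f ≡ sum (λ i → f (i ↑ˡ b)) + sum (λ i → f (a ↑ʳ i))
sum-split zero f = refl
sum-split (suc a) {b} f =
  trans (cong (f Fin.zero +_) (sum-split a (f ∘ Fin.suc))) (sym (+-assoc (f Fin.zero) _ _))

module Flatten {a : ℕ} (D : BBDigraph a) where

  -- A single index set for both partite sets makes the sums, permutations and orbits over `Fin n`
  -- applicable; the partite set survives as the Boolean `side`.
  vertex : Fin (a + a) → Vertex a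
  vertex = splitAt a

  index : Vertex a → Fin (a + a)
  index = join a a

  vertex-injective : Injective _≡_ _≡_ vertex
  vertex-injective {i} {j} e =
    trans (sym (Fin.join-splitAt a a i)) (trans (cong index e) (Fin.join-splitAt a a j))

  vertex-index : ∀ v → vertex (index v) ≡ v
  vertex-index = Fin.splitAt-join a a

  E : Fin (a + a) → Fin (a + a) → Bool
  E i j = arcB D (vertex i) (vertex j)

  isX : Vertex a → Bool
  isX (inj₁ _) = true
  isX (inj₂ _) = false

  side : Fin (a + a) → Bool
  side = isX ∘ vertex

  bip : ∀ i j → E i j ≡ true → side j ≡ not (side i)
  bip i j = go (vertex i) (vertex j)
    where
    go : ∀ u v → arcB D u v ≡ true → isX v ≡ not (isX u)
    go (inj₁ _) (inj₂ _) _ = refl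
    go (inj₂ _) (inj₁ _) _ = refl

  open Bipartite E side bip

  count-vertices : ∀ (f : Vertex a → Bool) → countV f ≡ ∣ f ∘ vertex ∣
  count-vertices f = sym (begin
    ∣ f ∘ vertex ∣ ≡⟨ sum-split a (ι ∘ f ∘ vertex) ⟩
    sum (λ i → ι (f (splitAt a (i ↑ˡ a)))) + sum (λ i → ι (f (splitAt a (a ↑ʳ i))))
      ≡⟨ cong₂ _+_ (sum-cong-≗ λ i → cong (ι ∘ f) (Fin.splitAt-↑ˡ a i a))
        (sum-cong-≗ λ i → cong (ι ∘ f) (Fin.splitAt-↑ʳ a a i)) ⟩
    ∣ f ∘ inj₁ ∣ + ∣ f ∘ inj₂ ∣ ≡⟨ cong₂ _+_ (countF≡sum (f ∘ inj₁)) (countF≡sum (f ∘ inj₂)) ⟨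
    countV f ∎)
    where open ≡-Reasoning

  degree-vertex : ∀ i → Defs.deg D (vertex i) ≡ degree i
  degree-vertex i =
    cong₂ _+_ (count-vertices (arcB D (vertex i))) (count-vertices (λ w → arcB D w (vertex i)))

  balanced : Sized (λ _ → true) a
  balanced b = trans (sym (count-vertices (λ v → b xor isX v)))
    (trans (cong₂ _+_ (countF≡sum {a} (λ _ → b xor true)) (countF≡sum {a} (λ _ → b xor false)))
    (halves b))
    where
    halves : ∀ b → ∣ (λ (_ : Fin a) → b xor true) ∣ + ∣ (λ (_ : Fin a) → b xor false) ∣ ≡ a
    halves true  = trans (cong₂ _+_ (sum-zero a) (trans (sum-const a 1) (*-identityʳ a))) refl
    halves false = trans (cong₂ _+_ (trans (sum-const a 1) (*-identityʳ a)) (sum-zero a)) (+-identityʳ a)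

  -- On a walk from `u` to `v`, the first arc whose head is outside `S` has its tail in `S`.
  crossing : StronglyConnected D → ∀ (S : Fin (a + a) → Bool) u v → S u ≡ true → S v ≡ false →
    ∃ λ x → ∃ λ y → S x ≡ true × S y ≡ false × E x y ≡ true
  crossing strong S u v u∈ v∉ = case go (strong (vertex u) (vertex v))
      (trans (cong S (Fin.join-splitAt a a u)) u∈) (trans (cong S (Fin.join-splitAt a a v)) v∉) of λ
    { (x , y , x∈ , y∉ , e) →
      index x , index y , x∈ , y∉ , trans (cong₂ (arcB D) (vertex-index x) (vertex-index y)) e }
    where
    go : ∀ {u v} → Star (Arc D) u v → S (index u) ≡ true → S (index v) ≡ false →
      ∃ λ x → ∃ λ y → S (index x) ≡ true × S (index y) ≡ false × Arc D x y
    go ε p q = true≢false p q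
    go {u} (_◅_ {j = w} e path) p q with S (index w) in w∈
    ... | true  = go path w∈ q
    ... | false = u , w , p , w∈ , e

  toCycle : ∀ {m c} → Cycles.Cycle E m c → IsCycle D m (vertex ∘ c ∘ toℕ)
  toCycle {m} {c} (c-inj , c-arcs , c-close) =
    (λ {i} {j} e →
      Fin.toℕ-injective (c-inj (toℕ i) (toℕ j) (Fin.toℕ<n i) (Fin.toℕ<n j) (vertex-injective e))) , arc
    where
    arc : ∀ i → Arc D (vertex (c (toℕ i))) (vertex (c (toℕ (sucMod i))))
    arc i = case m≤n⇒m<n∨m≡n (Fin.toℕ<n i) of λ
      { (inj₁ lt) → trans (cong (E (c (toℕ i)) ∘ c) (sucMod-suc i lt)) (c-arcs (toℕ i) lt)
      ; (inj₂ e) → trans (cong (E (c (toℕ i)) ∘ c) (sucMod-last i e)) (c-close (toℕ i) e) }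

  directedCycle : ∀ {N r} → Position N r (2 * a) → (∀ u → E u (N u) ≡ true) →
    (∀ u v → E u v ≡ true → N u ≡ v) → IsDirectedCycle D
  directedCycle {N} {r} P arcs only =
    vertex ∘ iterate N r ∘ toℕ , toCycle (Cycles.position-cycle E P arcs) , every
    where
    open Position P
    next : ∀ i → iterate N r (toℕ (sucMod {2 * a} i)) ≡ N (iterate N r (toℕ i))
    next i = case m≤n⇒m<n∨m≡n (Fin.toℕ<n i) of λ
      { (inj₁ lt) → trans (cong (iterate N r) (sucMod-suc i lt)) (iterate-suc N r (toℕ i))
      ; (inj₂ e) → trans (cong (iterate N r) (sucMod-last i e))
        (trans (sym return) (trans (cong (iterate N r) (sym e)) (iterate-suc N r (toℕ i)))) }
    every : ∀ u v → Arc D u v → ∃ λ i →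
      vertex (iterate N r (toℕ i)) ≡ u × vertex (iterate N r (toℕ (sucMod {2 * a} i))) ≡ v
    every u v e = i , trans (cong vertex at-i) (vertex-index u) ,
      trans (cong vertex
        (trans (next i)
        (trans (cong N at-i)
        (only (index u) (index v) (trans (cong₂ (arcB D) (vertex-index u) (vertex-index v)) e)))))
        (vertex-index v)
      where
      i : Fin (2 * a)
      i = Fin.fromℕ< (pos< (index u))
      at-i : iterate N r (toℕ i) ≡ index u
      at-i = trans (cong (iterate N r) (Fin.toℕ-fromℕ< (pos< (index u)))) (at (index u))

theorem1p5 : (a : ℕ) (D : BBDigraph a) (k : ℕ) →
    3 ≤ a → 1 < k → a < 4 * k → 2 * k ≤ a →
    StronglyConnected D →
    (∀ u v → Dominating D u v →
    ((2 * a ≤ deg D u + k) × (a + k ≤ deg D v)) ⊎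
    ((a + k ≤ deg D u) × (2 * a ≤ deg D v + k))) →
    Bipancyclic D ⊎ IsDirectedCycle D
theorem1p5 a D k 3≤a 1<k a<4k 2k≤a strong dom = case any? (λ u → B.degree u <? a + k) of λ
  { (yes (u , low)) → let module L = LowDegree E side bip balanced 1<k 1≤a pairs (crossing strong) u low in
      inj₂ (directedCycle L.traversal L.N-arcs L.N-unique)
  ; (no none) → inj₁ λ m 1≤m m≤a →
      let c , cycle = ShortCycles.even-cycle (conditions λ u → ≮⇒≥ λ low → none (u , low)) some-vertex m 1≤m m≤a
      in vertex ∘ c ∘ toℕ , toCycle cycle }
  where
  open Flatten D
  module B = Bipartite E side bip
  1≤a : 1 ≤ a
  1≤a = ≤-trans (s≤s z≤n) 3≤a
  some-vertex : Fin (a + a)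
  some-vertex = Fin.fromℕ< (≤-trans 1≤a (m≤m+n a a))
  h : ℕ
  h = 2 * a ∸ k
  k≤2a : k ≤ 2 * a
  k≤2a = ≤-trans (m≤m+n k _) (≤-trans 2k≤a (m≤m+n a _))
  at-least-h : ∀ {d} → 2 * a ≤ d + k → h ≤ d
  at-least-h {d} le = m≤n+o⇒m∸n≤o (2 * a) k (≤-trans le (≤-reflexive (+-comm d k)))
  -- The bound `2 * k ≤ a` makes the threshold `2a - k` at least `a + k`.
  at-least-a+k : ∀ {d} → 2 * a ≤ d + k → a + k ≤ d
  at-least-a+k {d} le = +-cancelʳ-≤ k _ _ (begin
    a + k + k ≡⟨ eq a k ⟩
    a + 2 * k ≤⟨ +-monoʳ-≤ a 2k≤a ⟩
    a + a ≡⟨ cong (a +_) (+-identityʳ a) ⟨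
    2 * a ≤⟨ le ⟩
    d + k ∎)
    where
    open ≤-Reasoning
    eq : ∀ a k → a + k + k ≡ a + 2 * k
    eq = solve-∀
  dominating-pair : ∀ u v w → E u w ≡ true → E v w ≡ true → ¬ (u ≡ v) →
    ((2 * a ≤ B.degree u + k) × (a + k ≤ B.degree v)) ⊎ ((a + k ≤ B.degree u) × (2 * a ≤ B.degree v + k))
  dominating-pair u v w uw vw u≢v rewrite sym (degree-vertex u) | sym (degree-vertex v) =
    dom (vertex u) (vertex v) (u≢v ∘ vertex-injective , vertex w , uw , vw)
  pairs : ∀ u v w → E u w ≡ true → E v w ≡ true → ¬ (u ≡ v) → a + k ≤ B.degree u
  pairs u v w uw vw u≢v = case dominating-pair u v w uw vw u≢v of λ
    { (inj₁ (p , _)) → at-least-a+k p ; (inj₂ (p , _)) → p }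
  conditions : (∀ u → a + k ≤ B.degree u) → Conditions E side bip a k (a ∸ 2 * k) h
  conditions minDegree = record
    { balanced = balanced ; 2≤k = 1<k ; a<4k = a<4k ; δ-def = m+[n∸m]≡n 2k≤a ; h-def = m∸n+n≡m k≤2a
    ; minDegree = minDegree ; strong = crossing strong
    ; dominating = λ u v w uw vw u≢v → case dominating-pair u v w uw vw u≢v of λ
        { (inj₁ (p , _)) → inj₁ (at-least-h p) ; (inj₂ (_ , p)) → inj₂ (at-least-h p) } }
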